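{- Let $n\ge1$ and let $\mathbf P=(\Delta_T)_{\emptyset\ne T\subseteq[n]}$, where $\Delta_T=\mathrm{conv}(\mathbf e_i\mid i\in T)\subset\mathbb{R}^n$, with variables $\mathbf x=(x_T)_{\emptyset\neq T\subseteq[n]}$. When $\langle\mathbf x,\mathbf 1\rangle=\sum_T x_T=0$, or equivalently, after substituting $x_{[n]}=-\sum_{\emptyset\ne T\subsetneq[n]}x_T$, the hyperplane dual mixed volume of the generalized permutohedron is $$\tilde m_{\mathbf P}(\mathbf x)|_{\langle\mathbf x,\mathbf 1\rangle=0}=(-1)^{n-1}\sum_{\sigma\in S_n}\ \prod_{a=1}^{n-1}\frac{1}{\displaystyle\sum_{\emptyset\ne T\subseteq\sigma[1:a]}x_T},$$ where $\sigma[1:a]=\{\sigma(1),\ldots,\sigma(a)\}$.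
   Context: The generalized permutohedron is $\mathbf x\mathbf P=\sum_{\emptyset\ne T\subseteq[n]}x_T\Delta_T$. Hyperplane dual mixed volume: let $H_t=\{\mathbf y\in\mathbb{R}^n:y_1+\cdots+y_n=t\}$ and let $\mathbf P=(P_1,\dots,P_r)$ be polytopes in $H_1$ whose Minkowski sum $P$ has dimension $n-1$. Let $\mathrm{cone}(P)=\{t\mathbf y:\mathbf y\in P,t\ge0\}$ and $\mathrm{cone}(P)^*=\{\mathbf v:\langle\mathbf v,\mathbf y\rangle\ge0\ \forall\mathbf y\in\mathrm{cone}(P)\}$. With $h_{P_i}(\mathbf v)=-\min_{\mathbf y\in P_i}\langle\mathbf v,\mathbf y\rangle$ and $\mathcal T$ a triangulation of the boundary of $\mathrm{cone}(P)^*$ into $(n-1)$-dimensional simplicial cones, $$\tilde m_{\mathbf P}(\mathbf x,\mathbf z)=\sum_{F=\mathrm{span}_{\ge0}(\mathbf v_1,\dots,\mathbf v_{n-1})\in\mathcal T}\frac{|\det(\mathbf v_1,\dots,\mathbf v_{n-1},\mathbf 1)|}{\prod_{j=1}^{n-1}\bigl(\sum_{i}x_ih_{P_i}(\mathbf v_j)+\langle\mathbf v_j,\mathbf z\rangle\bigr)},\qquad\mathbf 1=(1,\dots,1),$$ (independent of $\mathcal T$). Here $\tilde m_{\mathbf P}(\mathbf x)$ means $\tilde m_{\mathbf P}(\mathbf x,\mathbf 0)$, and $|_{\langle\mathbf x,\mathbf 1\rangle=0}$ denotes restriction of this rational function to the hyperplane where the sum of all the variables $\mathbf x$ is zero. 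-}

module Defs where

open import Level using (Level; _⊔_) renaming (suc to lsuc)
open import Algebra.Bundles using (CommutativeRing)
open import Algebra.Structures using (IsCommutativeRing)
import Algebra.Properties.CommutativeMonoid.Sum as CMSum
import Algebra.Properties.Semiring.Exp as SemiringExp
import Algebra.Properties.Semiring.Sum as SemiringSum
import Algebra.Properties.Ring as RingProperties
open import Data.Bool.Base using (if_then_else_)
open import Data.Fin.Base using (Fin; zero; suc; toℕ; fromℕ; punchIn)
open import Data.Fin.Permutation as Perm using (Permutation′; _⟨$⟩ʳ_; insert)
open import Data.Fin.Properties using (_≟_)
open import Data.Fin.Subset
  using (Subset; inside; outside; ⊤; _∈_; _∉_; Nonempty; ⁅_⁆; ⋃)
open import Data.Fin.Subset.Properties using (nonempty?; _∈?_; _⊆?_; drop-there)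
open import Data.List.Base as List
  using (List; []; _∷_; _++_; allFin; concatMap; filter; mapMaybe)
open import Data.Maybe.Base as Maybe using (Maybe)
open import Data.Nat.Base using (ℕ; zero; suc)
open import Data.Nat.Properties using (_<?_)
open import Data.Product.Base using (Σ-syntax; ∃; _×_; _,_; proj₁; proj₂)
open import Data.Sum.Base using (inj₁; inj₂)
open import Data.Vec.Base using ([]; _∷_; here; there)
import Data.Vec.Functional as VecF
open import Function.Base using (_∘_)
open import Function.Bundles using (_⇔_)
open import Relation.Binary.PropositionalEquality
open import Relation.Binary.Structures using (IsDecTotalOrder)
open import Relation.Nullary using (¬_; does; yes; no; contradiction)
open import Relation.Nullary.Decidable using (True; toWitness; fromWitness; dec⇒maybe)
open import Relation.Unary as U using (Pred)

------------------------------------------------------------------------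
-- Subsets and permutations of [n], both with 0-based elements

-- `True (nonempty? T)` rather than `Nonempty T`, so that a nonempty subset
-- is determined by T alone and a family x_T has one member for each T.
NonemptySubset : ℕ → Set
NonemptySubset n = Σ[ T ∈ Subset n ] True (nonempty? T)

subsets : ∀ n → List (Subset n)
subsets zero    = [] ∷ []
subsets (suc n) = List.map (outside ∷_) (subsets n) ++ List.map (inside ∷_) (subsets n)

nonemptySubsets : ∀ n → List (NonemptySubset n)
nonemptySubsets n =
  mapMaybe (λ T → Maybe.map (λ ne → T , fromWitness ne) (dec⇒maybe (nonempty? T)))
           (subsets n)

-- A permutation of [n+1] is given by the image j of its first element and a
-- permutation of the remaining n elements.
permutations : ∀ n → List (Permutation′ n)
permutations zero    = Perm.id ∷ []
permutations (suc n) =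
  concatMap (λ j → List.map (insert zero j) (permutations n)) (allFin (suc n))

-- σ[1:a] = {σ(1), …, σ(a)}
initialSegment : ∀ {n} → Permutation′ n → ℕ → Subset n
initialSegment {n} σ a =
  ⋃ (List.map (λ i → ⁅ σ ⟨$⟩ʳ i ⁆) (filter (λ i → toℕ i <? a) (allFin n)))

------------------------------------------------------------------------
-- Ordered fields

record OrderedField c ℓ : Set (lsuc (c ⊔ ℓ)) where
  infix  8 _⁻¹ -_
  infixl 7 _*_
  infixl 6 _+_
  infix  4 _≤_
  field
    Carrier           : Set c
    _≤_               : Carrier → Carrier → Set ℓ
    _+_ _*_           : Carrier → Carrier → Carrier
    -_ _⁻¹            : Carrier → Carrier
    0# 1#             : Carrier
    isCommutativeRing : IsCommutativeRing _≡_ _+_ _*_ -_ 0# 1#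
    0≢1               : 0# ≢ 1#
    -- The value of 0# ⁻¹ is unspecified.
    *-inverseʳ        : ∀ x → x ≢ 0# → x * x ⁻¹ ≡ 1#
    isDecTotalOrder   : IsDecTotalOrder _≡_ _≤_
    +-monoˡ-≤         : ∀ z {x y} → x ≤ y → x + z ≤ y + z
    *-nonNegative     : ∀ {x y} → 0# ≤ x → 0# ≤ y → 0# ≤ x * y

  open IsDecTotalOrder isDecTotalOrder public
    using (_≤?_; module Eq)
    renaming (refl to ≤-refl; reflexive to ≤-reflexive; trans to ≤-trans;
              antisym to ≤-antisym; total to ≤-total; _≟_ to _≟ᴷ_)

  commutativeRing : CommutativeRing c c
  commutativeRing = record { isCommutativeRing = isCommutativeRing }

  open CommutativeRing commutativeRing public
    using (semiring; ring; *-commutativeMonoid; +-comm; +-assoc; +-identityˡ;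
           +-identityʳ; *-comm; *-assoc; *-identityˡ; *-identityʳ; distribˡ;
           distribʳ; zeroˡ; zeroʳ; -‿inverseˡ; -‿inverseʳ)

  infix 4 _<_
  _<_ : Carrier → Carrier → Set (c ⊔ ℓ)
  x < y = x ≤ y × x ≢ y

  infixl 6 _-_
  _-_ : Carrier → Carrier → Carrier
  x - y = x + (- y)

  ∣_∣ : Carrier → Carrier
  ∣ x ∣ = if does (0# ≤? x) then x else (- x)

  open SemiringExp semiring public using (_^_)

  ∑ : ∀ {n} → (Fin n → Carrier) → Carrier
  ∑ = SemiringSum.sum semiring

  ∏ : ∀ {n} → (Fin n → Carrier) → Carrier
  ∏ = CMSum.sum *-commutativeMonoid

  ∑ₗ : ∀ {a} {A : Set a} → List A → (A → Carrier) → Carrier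
  ∑ₗ as f = List.foldr _+_ 0# (List.map f as)

  infixl 5 ∑ₗ
  syntax ∑ₗ as (λ a → t) = ∑[ a ∈ as ] t

------------------------------------------------------------------------
-- Polytopes and cones in Kⁿ

module Geometry {c ℓ} (K : OrderedField c ℓ) where
  open OrderedField K

  Point : ℕ → Set c
  Point n = VecF.Vector Carrier n

  ⟨_,_⟩ : ∀ {n} → Point n → Point n → Carrier
  ⟨ v , y ⟩ = ∑ λ k → v k * y k

  𝟎 𝟏 : ∀ {n} → Point n
  𝟎 _ = 0#
  𝟏 _ = 1#

  basis : ∀ {n} → Fin n → Point n
  basis i k = if does (i ≟ k) then 1# else 0#

  combination : ∀ {r n} → (Fin r → Carrier) → (Fin r → Point n) → Point n
  combination w p k = ∑ λ i → w i * p i k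

  PointSet : ℕ → Set (c ⊔ lsuc (c ⊔ ℓ))
  PointSet n = Pred (Point n) (c ⊔ ℓ)

  NonNegativeOn : ∀ {r} → Subset r → (Fin r → Carrier) → Set (c ⊔ ℓ)
  NonNegativeOn S w = (∀ i → 0# ≤ w i) × (∀ i → i ∉ S → w i ≡ 0#)

  -- The hulls of { p i ∣ i ∈ S }.
  conv span≥0 : ∀ {r n} → Subset r → (Fin r → Point n) → PointSet n
  conv   S p y = ∃ λ w → NonNegativeOn S w × ∑ w ≡ 1# × y ≗ combination w p
  span≥0 S p y = ∃ λ w → NonNegativeOn S w × y ≗ combination w p

  -- The polytope conv { point i ∣ i ∈ support }.
  record Polytope (n : ℕ) : Set c where
    field
      {size}   : ℕ
      support  : Subset size
      point    : Fin size → Point n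
      nonempty : Nonempty support

  ⟦_⟧ : ∀ {n} → Polytope n → PointSet n
  ⟦ P ⟧ = conv (Polytope.support P) (Polytope.point P)

  IsMinimum : ∀ {n} → PointSet n → (Point n → Carrier) → Carrier → Set (c ⊔ ℓ)
  IsMinimum X f m = (∃ λ y → X y × f y ≡ m) × (∀ y → X y → m ≤ f y)

  module Lemmas where
    open SemiringSum semiring public using (∑-comm; *-distribˡ-sum; *-distribʳ-sum)

    sum-cong : ∀ {n} {f g : Fin n → Carrier} → (∀ i → f i ≡ g i) → ∑ f ≡ ∑ g
    sum-cong {zero}  h = refl
    sum-cong {suc n} h = cong₂ _+_ (h zero) (sum-cong (h ∘ suc))

    +-mono-≤ : ∀ {a b x y} → a ≤ b → x ≤ y → a + x ≤ b + y
    +-mono-≤ {a} {b} {x} {y} p q =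
      ≤-trans (+-monoˡ-≤ x p) (subst₂ _≤_ (+-comm x b) (+-comm y b) (+-monoˡ-≤ b q))

    *-monoˡ-≤ : ∀ {w x y} → 0# ≤ w → x ≤ y → w * x ≤ w * y
    *-monoˡ-≤ {w} {x} {y} 0≤w x≤y =
      subst₂ _≤_ (+-identityˡ _) eq (+-monoˡ-≤ (w * x) (*-nonNegative 0≤w 0≤y-x))
      where
      0≤y-x : 0# ≤ y - x
      0≤y-x = subst (_≤ y - x) (-‿inverseʳ x) (+-monoˡ-≤ (- x) x≤y)
      eq : w * (y - x) + w * x ≡ w * y
      eq = trans (sym (distribˡ w _ _)) (cong (w *_)
             (trans (+-assoc y _ _) (trans (cong (y +_) (-‿inverseˡ x)) (+-identityʳ y))))

    sum-mono-≤ : ∀ {n} {f g : Fin n → Carrier} → (∀ i → f i ≤ g i) → ∑ f ≤ ∑ g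
    sum-mono-≤ {zero}  h = ≤-refl
    sum-mono-≤ {suc n} h = +-mono-≤ (h zero) (sum-mono-≤ (h ∘ suc))

    sum-zero : ∀ {n} {f : Fin n → Carrier} → (∀ i → f i ≡ 0#) → ∑ f ≡ 0#
    sum-zero {zero}  h = refl
    sum-zero {suc n} h = trans (cong₂ _+_ (h zero) (sum-zero (h ∘ suc))) (+-identityˡ 0#)

    δ : ∀ {r} → Fin r → Fin r → Carrier
    δ = basis

    δ-refl : ∀ {r} (i : Fin r) → δ i i ≡ 1#
    δ-refl i with i ≟ i
    ... | yes _ = refl
    ... | no ¬p = contradiction refl ¬p

    δ-≢ : ∀ {r} {i j : Fin r} → i ≢ j → δ i j ≡ 0#
    δ-≢ {i = i} {j} i≢j with i ≟ j
    ... | yes p = contradiction p i≢j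
    ... | no _  = refl

    δ-suc : ∀ {r} (i j : Fin r) → δ (suc i) (suc j) ≡ δ i j
    δ-suc i j with i ≟ j
    ... | yes _ = refl
    ... | no _  = refl

    0≤1 : 0# ≤ 1#
    0≤1 with ≤-total 0# 1#
    ... | inj₁ p = p
    ... | inj₂ p = subst (0# ≤_) (-1*-1) (*-nonNegative 0≤-1 0≤-1)
      where
      open RingProperties ring using (-‿distribˡ-*; -‿involutive)
      0≤-1 : 0# ≤ - 1#
      0≤-1 = subst₂ _≤_ (-‿inverseʳ 1#) (+-identityˡ _) (+-monoˡ-≤ (- 1#) p)
      -1*-1 : (- 1#) * (- 1#) ≡ 1#
      -1*-1 = trans (sym (-‿distribˡ-* 1# (- 1#)))
                (trans (cong -_ (*-identityˡ (- 1#))) (-‿involutive 1#))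

    0≤δ : ∀ {r} (i j : Fin r) → 0# ≤ δ i j
    0≤δ i j with i ≟ j
    ... | yes _ = 0≤1
    ... | no _  = ≤-refl

    ∑δ* : ∀ {r} (i : Fin r) (f : Fin r → Carrier) → ∑ (λ j → δ i j * f j) ≡ f i
    ∑δ* zero f =
      trans (cong₂ _+_ (*-identityˡ _) (sum-zero λ j → zeroˡ (f (suc j)))) (+-identityʳ _)
    ∑δ* (suc i) f =
      trans (cong₂ _+_ (zeroˡ _)
               (trans (sum-cong λ j → cong (_* f (suc j)) (δ-suc i j)) (∑δ* i (f ∘ suc))))
            (+-identityˡ _)

    argmin : ∀ {r} (S : Subset r) → Nonempty S → (f : Fin r → Carrier) →
             ∃ λ i → i ∈ S × (∀ j → j ∈ S → f i ≤ f j)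
    argmin (s ∷ S) ne f with nonempty? S
    argmin (inside ∷ S) ne f | yes ne′ with argmin S ne′ (f ∘ suc)
    ... | i , i∈S , min with ≤-total (f zero) (f (suc i))
    ...   | inj₁ p = zero , here , λ { zero _ → ≤-refl ; (suc j) (there q) → ≤-trans p (min j q) }
    ...   | inj₂ p = suc i , there i∈S , λ { zero _ → p ; (suc j) (there q) → min j q }
    argmin (outside ∷ S) ne f | yes ne′ with argmin S ne′ (f ∘ suc)
    ... | i , i∈S , min = suc i , there i∈S , λ { (suc j) (there q) → min j q }
    argmin (inside ∷ S) ne f | no ¬ne =
      zero , here , λ { zero _ → ≤-refl ; (suc j) (there q) → contradiction (j , q) ¬ne }
    argmin (outside ∷ S) (suc i , q) f | no ¬ne = contradiction (i , drop-there q) ¬ne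

    pairing-combination : ∀ {r n} (v : Point n) (w : Fin r → Carrier) (p : Fin r → Point n) →
                          ⟨ v , combination w p ⟩ ≡ ∑ (λ i → w i * ⟨ v , p i ⟩)
    pairing-combination v w p =
      trans (sum-cong λ k → *-distribˡ-sum (v k) (λ i → w i * p i k))
        (trans (∑-comm (λ k i → v k * (w i * p i k)))
          (sum-cong λ i → trans (sum-cong λ k → swap (v k) (w i) (p i k))
                                (sym (*-distribˡ-sum (w i) (λ k → v k * p i k)))))
      where
      swap : ∀ a b d → a * (b * d) ≡ b * (a * d)
      swap a b d = trans (sym (*-assoc a b d)) (trans (cong (_* d) (*-comm a b)) (*-assoc b a d))

  open Lemmas

  minimum : ∀ {n} (P : Polytope n) (v : Point n) → ∃ (IsMinimum ⟦ P ⟧ ⟨ v ,_⟩)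
  minimum P v with argmin support nonempty (λ i → ⟨ v , point i ⟩)
    where open Polytope P
  ... | i , i∈S , min =
    ⟨ v , point i ⟩ , (point i , vertex , refl) , lower
    where
    open Polytope P
    vertex : ⟦ P ⟧ (point i)
    vertex = δ i , (0≤δ i , λ j j∉S → δ-≢ {i = i} {j} λ { refl → j∉S i∈S })
           , trans (sum-cong λ j → sym (*-identityʳ (δ i j))) (∑δ* i (λ _ → 1#))
           , λ k → sym (∑δ* i (λ j → point j k))

    lower : ∀ y → ⟦ P ⟧ y → ⟨ v , point i ⟩ ≤ ⟨ v , y ⟩
    lower y (w , (0≤w , w∉) , ∑w≡1 , y≗) = subst₂ _≤_
      (trans (sym (*-distribʳ-sum ⟨ v , point i ⟩ w))
             (trans (cong (_* ⟨ v , point i ⟩) ∑w≡1) (*-identityˡ _)))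
      (sym (trans (sum-cong λ k → cong (v k *_) (y≗ k)) (pairing-combination v w point)))
      (sum-mono-≤ term)
      where
      term : ∀ j → w j * ⟨ v , point i ⟩ ≤ w j * ⟨ v , point j ⟩
      term j with j ∈? support
      ... | yes j∈S = *-monoˡ-≤ (0≤w j) (min j j∈S)
      ... | no  j∉S rewrite w∉ j j∉S = ≤-reflexive (trans (zeroˡ _) (sym (zeroˡ _)))

  -- h_P(v) = −min_{y ∈ P} ⟨v, y⟩
  h : ∀ {n} → Polytope n → Point n → Carrier
  h P v = - proj₁ (minimum P v)

  -- Minkowski sum of the family P, the index type I being enumerated by `is`.
  minkowskiSum : ∀ {n} {I : Set} → List I → (I → Polytope n) → PointSet n
  minkowskiSum {n} {I} is P y =
    ∃ λ (ys : I → Point n) → (∀ i → ⟦ P i ⟧ (ys i)) × (∀ k → y k ≡ (∑[ i ∈ is ] ys i k))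

  cone : ∀ {n} → PointSet n → PointSet n
  cone X y = ∃ λ t → ∃ λ y′ → 0# ≤ t × X y′ × (∀ k → y k ≡ t * y′ k)

  dual : ∀ {n} → PointSet n → PointSet n
  dual X v = ∀ y → X y → 0# ≤ ⟨ v , y ⟩

  -- The topological boundary.
  ∂ : ∀ {n} → PointSet n → PointSet n
  ∂ X v = ∀ ε → 0# < ε →
    (∃ λ y → Near ε y × X y) × (∃ λ y → Near ε y × ¬ X y)
    where
    Near : Carrier → Point _ → Set (c ⊔ ℓ)
    Near ε y = ∀ k → ∣ y k - v k ∣ < ε

  LinearlyIndependent : ∀ {r n} → (Fin r → Point n) → Set c
  LinearlyIndependent p = ∀ w → combination w p ≗ 𝟎 → ∀ i → w i ≡ 0#

  -- The cone spanned by the whole family p.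
  span : ∀ {r n} → (Fin r → Point n) → PointSet n
  span = span≥0 ⊤

  -- A set of simplicial cones, the a-th generated by F a 0, …, F a (m-1),
  -- with union X and such that any two of them meet in a common face.
  record IsTriangulation {n m r} (X : PointSet n) (F : Fin r → Fin m → Point n)
         : Set (c ⊔ ℓ) where
    field
      simplicial : ∀ a → LinearlyIndependent (F a)
      covers     : ∀ v → X v ⇔ (∃ λ a → span (F a) v)
      distinct   : ∀ a b → span (F a) U.≐ span (F b) → a ≡ b
      commonFace : ∀ a b → ∃ λ S → ∃ λ S′ →
                   (span (F a) U.∩ span (F b)) U.≐ span≥0 S (F a) ×
                   (span (F a) U.∩ span (F b)) U.≐ span≥0 S′ (F b)

  -- Laplace expansion along the first row.
  det : ∀ {n} → (Fin n → Point n) → Carrier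
  det {zero}  A = 1#
  det {suc n} A =
    ∑ λ j → (- 1#) ^ toℕ j * A zero j * det (λ i k → A (suc i) (punchIn j k))

  ----------------------------------------------------------------------
  -- The hyperplane dual mixed volume, in dimension n = m + 1

  module _ {m : ℕ} {I : Set} (is : List I) (P : I → Polytope (suc m)) where

    denominator : (I → Carrier) → Point (suc m) → Point (suc m) → Carrier
    denominator x z v = (∑[ i ∈ is ] (x i * h (P i) v)) + ⟨ v , z ⟩

    dualVolumeSum : ∀ {r} → (Fin r → Fin m → Point (suc m)) →
                    (I → Carrier) → Point (suc m) → Carrier
    dualVolumeSum F x z = ∑ λ a →
      ∣ det (VecF.insertAt (F a) (fromℕ m) 𝟏) ∣ *
      (∏ λ j → denominator x z (F a j)) ⁻¹

    -- m̃_𝐏 is a rational function, represented by its values: for every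
    -- triangulation it is given by the corresponding formula, wherever none
    -- of the denominators of that formula vanishes.
    IsHyperplaneDualMixedVolume : ((I → Carrier) → Point (suc m) → Carrier) → Set (c ⊔ ℓ)
    IsHyperplaneDualMixedVolume m̃ =
      ∀ {r} (F : Fin r → Fin m → Point (suc m)) →
      IsTriangulation (∂ (dual (cone (minkowskiSum is P)))) F →
      ∀ x z → (∀ a j → denominator x z (F a j) ≢ 0#) →
      m̃ x z ≡ dualVolumeSum F x z

  ----------------------------------------------------------------------
  -- Simplices

  -- Δ_T = conv { e_i ∣ i ∈ T }
  Δ : ∀ {n} → NonemptySubset n → Polytope n
  Δ (T , ne) = record { support = T ; point = basis ; nonempty = toWitness ne }

  -- Σ_{∅ ≠ T ⊆ A} x_T
  ∑⊆ : ∀ {n} → Subset n → (NonemptySubset n → Carrier) → Carrier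
  ∑⊆ {n} A x = ∑[ T ∈ filter (λ T → proj₁ T ⊆? A) (nonemptySubsets n) ] x T

-- Let g(v) = Σ_T min_{i∈T} v_i. A vector v lies in cone(P)* iff g(v) ≥ 0, and
-- since g(v + t𝟏) = g(v) + N t, with N the number of nonempty T, the boundary
-- of cone(P)* is { g = 0 }. The chambers v_σ(1) ≥ … ≥ v_σ(n) of the braid fan,
-- cut with { g = 0 }, triangulate it: on a chamber min_{i∈T} v_i is the value
-- of v at the element of T that is last under σ, so g is linear there, and the
-- coordinates of v in the cone of σ are the drops v_σ(j) − v_σ(j+1) along the
-- rays e_B − (g(e_B)/N) 𝟏, e_B = Σ_{i∈B} e_i, B = σ[1:j], which lie on { g = 0 }.
--
-- A determinant of such rays bordered by 𝟏 is ±1. On the ray of B the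
-- denominator is −Σ_{T⊆B} x_T + (g(e_B)/N) Σ_T x_T, whose second term vanishes
-- by hypothesis.

module Submission where

open import Defs
open import Algebra.Solver.Ring.AlmostCommutativeRing
  using (AlmostCommutativeRing; fromCommutativeRing; _-Raw-AlmostCommutative⟶_)
import Algebra.Properties.Ring as RingProperties
import Algebra.Properties.Semiring.Mult.TCOptimised as Mult
import Algebra.Properties.Semiring.Sum as SemiringSum
import Algebra.Solver.Ring as RingSolver
open import Data.Bool.Base using (if_then_else_)
import Data.Bool.Properties as Bool
open import Data.Fin.Base as Fin
  using (Fin; zero; suc; toℕ; fromℕ; punchIn; pinch; inject₁; fromℕ<; lower₁)
open import Data.Fin.Permutation as Perm
  using (Permutation′; _⟨$⟩ʳ_; _⟨$⟩ˡ_; insert; remove; punchIn-permute; inverseˡ; inverseʳ)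
open import Data.Fin.Properties as Fin
  using (punchIn-injective; pigeonhole; toℕ<n; toℕ-fromℕ<; toℕ-inject₁; toℕ-injective;
         inject₁-lower₁)
open import Data.Fin.Subset using (Subset; Nonempty; ⊤; _∈_; _∉_; ⋃; ⁅_⁆; inside; outside)
open import Data.Fin.Subset.Properties
  using (∉⊥; ∈⊤; x∈p∪q⁻; x∈p∪q⁺; x∈⁅x⁆; x∈⁅y⁆⇒x≡y; nonempty?; _∈?_; _⊆?_; ⊆-antisym)
open import Data.Integer.Base as ℤ using (ℤ; +_; -[1+_]; _⊖_; _◃_)
import Data.Integer.Properties as ℤ
open import Data.List.Base as List using (List; []; _∷_; allFin; length; lookup; map; filter)
import Data.List.Extrema as Extrema
open import Data.List.Membership.Propositional using (find; lose) renaming (_∈_ to _∈ₗ_)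
open import Data.List.Membership.Propositional.Properties
  using (∈-allFin; ∈-lookup; ∈-filter⁺; ∈-filter⁻; ∈-map⁺; ∈-++⁺ʳ)
open import Data.List.Relation.Unary.All as All using ([]; _∷_)
import Data.List.Relation.Unary.All.Properties as All
open import Data.List.Relation.Unary.AllPairs as AllPairs using (AllPairs; []; _∷_)
import Data.List.Relation.Unary.AllPairs.Properties as AllPairs
open import Data.List.Relation.Unary.Any as Any using (Any; here; there)
import Data.List.Relation.Unary.Any.Properties as Any
import Data.Maybe.Base as Maybe
open import Data.Maybe.Relation.Unary.Any as MAny using (just)
open import Data.Nat.Base as ℕ using (ℕ; zero; suc; z≤n; s≤s)
import Data.Nat.Properties as ℕ
open import Data.Product.Base using (∃; _×_; _,_; proj₁; proj₂)
open import Data.Sign.Base as Sign using (Sign)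
open import Data.Sum.Base using (_⊎_; inj₁; inj₂; [_,_]′)
open import Data.Unit.Base using (tt) renaming (⊤ to Unit)
open import Data.Vec.Base as Vec using (here; there)
import Data.Vec.Functional as VecF
open import Data.Vec.Properties using (lookup∘tabulate; []=⇒lookup; lookup⇒[]=; ≡-dec)
open import Function.Base using (_∘_)
open import Function.Bundles using (mk⇔)
open import Relation.Binary.Bundles using (TotalOrder)
open import Relation.Binary.Definitions using (DecidableEquality; tri<; tri≈; tri>)
open import Relation.Binary.PropositionalEquality
open import Relation.Binary.Structures using (module IsDecTotalOrder)
open import Relation.Nullary using (¬_; yes; no; does; contradiction)
open import Relation.Nullary.Decidable
  using (toWitness; fromWitness; dec⇒maybe; dec-true; dec-false)
open import Relation.Unary using (Decidable; _∩_; _≐_)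

-- Integer coefficients for the ring solver

module IntegerRingSolver {c ℓ} (K : OrderedField c ℓ) where
  open OrderedField K using (Carrier; _+_; _*_; -_; 0#; 1#; _-_; commutativeRing; semiring;
                             ring; +-assoc; +-comm; +-identityˡ; +-identityʳ; -‿inverseʳ)
  open Mult semiring using (1+×; ×-homo-+; ×1-homo-*) renaming (_×_ to _·_)
  open RingProperties ring
    using (-‿distribˡ-*; -‿distribʳ-*; -‿involutive; -0#≈0#; -‿+-comm)
  open ≡-Reasoning

  private
    target : AlmostCommutativeRing c c
    target = fromCommutativeRing commutativeRing

    signed : Sign → Carrier → Carrier
    signed Sign.+ x = x
    signed Sign.- x = - x

    -- With the optimised multiple, `1 · 1#` reduces to `1#`. Hence `con (+ 1)` denotes `1#` itself,
    -- and solver goals that contain constants close by `refl`.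
    ⟦_⟧ : ℤ → Carrier
    ⟦ i ⟧ = signed (ℤ.sign i) (ℤ.∣ i ∣ · 1#)

    ◃-homo : ∀ s n → ⟦ s ◃ n ⟧ ≡ signed s (n · 1#)
    ◃-homo Sign.+ zero    = refl
    ◃-homo Sign.- zero    = sym -0#≈0#
    ◃-homo Sign.+ (suc n) = refl
    ◃-homo Sign.- (suc n) = refl

    signed-* : ∀ s t x y → signed (s Sign.* t) (x * y) ≡ signed s x * signed t y
    signed-* Sign.+ Sign.+ x y = refl
    signed-* Sign.+ Sign.- x y = -‿distribʳ-* x y
    signed-* Sign.- Sign.+ x y = -‿distribˡ-* x y
    signed-* Sign.- Sign.- x y = begin
      x * y          ≡⟨ -‿involutive _ ⟨
      - - (x * y)    ≡⟨ cong -_ (-‿distribʳ-* x y) ⟩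
      - (x * - y)    ≡⟨ -‿distribˡ-* x (- y) ⟩
      (- x) * (- y)  ∎

    ⊖-homo : ∀ m n → ⟦ m ⊖ n ⟧ ≡ m · 1# - n · 1#
    ⊖-homo zero    zero    = sym (-‿inverseʳ 0#)
    ⊖-homo zero    (suc n) = sym (+-identityˡ _)
    ⊖-homo (suc m) zero    = sym (trans (cong (λ z → suc m · 1# + z) -0#≈0#) (+-identityʳ _))
    ⊖-homo (suc m) (suc n) = begin
      ⟦ suc m ⊖ suc n ⟧            ≡⟨ cong ⟦_⟧ (ℤ.[1+m]⊖[1+n]≡m⊖n m n) ⟩
      ⟦ m ⊖ n ⟧                    ≡⟨ ⊖-homo m n ⟩
      a - b                        ≡⟨ cong (_- b) (+-identityˡ a) ⟨
      (0# + a) - b                 ≡⟨ cong (λ z → z + a - b) (-‿inverseʳ 1#) ⟨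
      (1# - 1# + a) - b            ≡⟨ cong (_- b) (trans (+-assoc 1# _ _) (cong (λ z → 1# + z) (+-comm _ a))) ⟩
      (1# + (a - 1#)) - b          ≡⟨ cong (_- b) (+-assoc 1# a _) ⟨
      (1# + a - 1#) - b            ≡⟨ +-assoc (1# + a) _ _ ⟩
      (1# + a) + (- 1# - b)        ≡⟨ cong (λ z → 1# + a + z) (-‿+-comm 1# b) ⟩
      (1# + a) - (1# + b)          ≡⟨ cong₂ _-_ (1+× m 1#) (1+× n 1#) ⟨
      suc m · 1# - suc n · 1#      ∎
      where
      a = m · 1#
      b = n · 1#

    +-homo : ∀ i j → ⟦ i ℤ.+ j ⟧ ≡ ⟦ i ⟧ + ⟦ j ⟧
    +-homo (+ m)      (+ n)      = ×-homo-+ 1# m n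
    +-homo (+ m)      -[1+ n ]   = ⊖-homo m (suc n)
    +-homo -[1+ m ]   (+ n)      = trans (⊖-homo n (suc m)) (+-comm _ _)
    +-homo -[1+ m ]   -[1+ n ]   = begin
      - (suc (suc (m ℕ.+ n)) · 1#)     ≡⟨ cong (λ k → - (k · 1#)) (cong suc (ℕ.+-suc m n)) ⟨
      - ((suc m ℕ.+ suc n) · 1#)       ≡⟨ cong -_ (×-homo-+ 1# (suc m) (suc n)) ⟩
      - (suc m · 1# + suc n · 1#)      ≡⟨ -‿+-comm _ _ ⟨
      - (suc m · 1#) - (suc n · 1#)    ∎

    -‿homo : ∀ i → ⟦ ℤ.- i ⟧ ≡ - ⟦ i ⟧
    -‿homo (+ zero)  = sym -0#≈0#
    -‿homo (+ suc n) = refl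
    -‿homo -[1+ n ]  = sym (-‿involutive _)

    morphism : ℤ.+-*-rawRing -Raw-AlmostCommutative⟶ target
    morphism = record
      { ⟦_⟧    = ⟦_⟧
      ; +-homo = +-homo
      ; *-homo = λ i j → begin
          ⟦ i ℤ.* j ⟧
            ≡⟨ ◃-homo (ℤ.sign i Sign.* ℤ.sign j) (ℤ.∣ i ∣ ℕ.* ℤ.∣ j ∣) ⟩
          signed (ℤ.sign i Sign.* ℤ.sign j) ((ℤ.∣ i ∣ ℕ.* ℤ.∣ j ∣) · 1#)
            ≡⟨ cong (signed (ℤ.sign i Sign.* ℤ.sign j)) (×1-homo-* ℤ.∣ i ∣ ℤ.∣ j ∣) ⟩
          signed (ℤ.sign i Sign.* ℤ.sign j) (ℤ.∣ i ∣ · 1# * (ℤ.∣ j ∣ · 1#))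
            ≡⟨ signed-* (ℤ.sign i) (ℤ.sign j) _ _ ⟩
          ⟦ i ⟧ * ⟦ j ⟧ ∎
      ; -‿homo = -‿homo
      ; 0-homo = refl
      ; 1-homo = refl
      }

  open RingSolver ℤ.+-*-rawRing target morphism
    (λ i j → Maybe.map (cong ⟦_⟧) (dec⇒maybe (i ℤ.≟ j))) public

-- Permutations and subsets

-- Phrased with `Any` and a predicate rather than with membership: permutations are records of
-- functions, so a given one need not be propositionally equal to a listed one.
permutations-complete : ∀ {p} {n} {P : Permutation′ (suc n) → Set p} (j : Fin (suc n)) →
  Any (P ∘ insert zero j) (permutations n) → Any P (permutations (suc n))
permutations-complete j p = Any.concatMap⁺ _ (lose (∈-allFin j) (Any.map⁺ p))

-- Blocks of the enumeration are told apart by the image of `zero`, and inside a block `punchIn j`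
-- is injective. This is what separates the cones of the fan.
permutations-distinct : ∀ n → AllPairs (λ σ τ → ¬ (σ Perm.≈ τ)) (permutations n)
permutations-distinct zero    = [] ∷ []
permutations-distinct (suc n) = AllPairs.concat⁺
  (All.map⁺ (All.universal
     (λ j → AllPairs.map⁺ (AllPairs.map
        (λ σ≉τ σ≈τ → σ≉τ λ i → punchIn-injective j _ _ (σ≈τ (suc i)))
        (permutations-distinct n)))
     (allFin (suc n))))
  (AllPairs.map⁺ (AllPairs.tabulate⁺ λ i≢j →
     All.map⁺ (All.universal
       (λ _ → All.map⁺ (All.universal (λ _ σ≈τ → i≢j (σ≈τ zero)) (permutations n)))
       (permutations n))))

lookup-injective : ∀ {a r} {A : Set a} {R : A → A → Set r} → (∀ {x y} → R x y → R y x) →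
                   ∀ {xs} → AllPairs (λ x y → ¬ R x y) xs →
                   ∀ i j → R (lookup xs i) (lookup xs j) → i ≡ j
lookup-injective R-sym (x∉ ∷ xs!) zero    zero    _ = refl
lookup-injective R-sym (x∉ ∷ xs!) zero    (suc j) r =
  contradiction r (All.lookup x∉ (∈-lookup j))
lookup-injective R-sym (x∉ ∷ xs!) (suc i) zero    r =
  contradiction (R-sym r) (All.lookup x∉ (∈-lookup i))
lookup-injective R-sym (x∉ ∷ xs!) (suc i) (suc j) r = cong suc (lookup-injective R-sym xs! i j r)

∈⋃⁺ : ∀ {n} {i : Fin n} {Ts} → Any (i ∈_) Ts → i ∈ ⋃ Ts
∈⋃⁺ (here i∈T)   = x∈p∪q⁺ (inj₁ i∈T)
∈⋃⁺ (there i∈Ts) = x∈p∪q⁺ (inj₂ (∈⋃⁺ i∈Ts))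

∈⋃⁻ : ∀ {n} {i : Fin n} Ts → i ∈ ⋃ Ts → Any (i ∈_) Ts
∈⋃⁻ []       i∈ = contradiction i∈ ∉⊥
∈⋃⁻ (T ∷ Ts) i∈ = [ here , there ∘ ∈⋃⁻ Ts ]′ (x∈p∪q⁻ T (⋃ Ts) i∈)

permutation-injective : ∀ {n} (σ : Permutation′ n) {i j} → σ ⟨$⟩ʳ i ≡ σ ⟨$⟩ʳ j → i ≡ j
permutation-injective σ eq = trans (sym (inverseˡ σ)) (trans (cong (σ ⟨$⟩ˡ_) eq) (inverseˡ σ))

module _ {n} (σ : Permutation′ n) where

  ∈-initialSegment⁺ : ∀ {i a} → toℕ i ℕ.< a → σ ⟨$⟩ʳ i ∈ initialSegment σ a
  ∈-initialSegment⁺ {i} {a} i<a = ∈⋃⁺ (Any.map⁺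
    (lose (∈-filter⁺ (λ i → toℕ i ℕ.<? a) (∈-allFin i) i<a) (x∈⁅x⁆ (σ ⟨$⟩ʳ i))))

  ∈-initialSegment⁻ : ∀ {i a} → σ ⟨$⟩ʳ i ∈ initialSegment σ a → toℕ i ℕ.< a
  ∈-initialSegment⁻ {i} {a} σi∈
    with find (Any.map⁻ (∈⋃⁻ (map (λ i → ⁅ σ ⟨$⟩ʳ i ⁆) (filter (λ i → toℕ i ℕ.<? a) (allFin n))) σi∈))
  ... | j , j∈ , σi∈⁅σj⁆ with ∈-filter⁻ (λ i → toℕ i ℕ.<? a) {xs = allFin n} j∈
  ...   | _ , j<a rewrite permutation-injective σ (x∈⁅y⁆⇒x≡y (σ ⟨$⟩ʳ j) σi∈⁅σj⁆) = j<a

module _ {a ℓ₁ ℓ₂} (O : TotalOrder a ℓ₁ ℓ₂) where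
  open TotalOrder O using (Carrier; _≤_)
  open Extrema O using (argmax; argmax-all; f[xs]≤f[argmax])

  -- Needed for two orders: that of the field, to find a largest coordinate when sorting, and that
  -- of ℕ, to find the element of T placed last by a permutation.
  maximiser : ∀ {n} (T : Subset n) → Nonempty T → (f : Fin n → Carrier) →
              ∃ λ i → i ∈ T × (∀ {j} → j ∈ T → f j ≤ f i)
  maximiser {n} T (i , i∈T) f =
    argmax f i elements ,
    argmax-all f i∈T (All.all-filter (_∈? T) (allFin n)) ,
    λ {j} j∈T → All.lookup (f[xs]≤f[argmax] i elements) (∈-filter⁺ (_∈? T) (∈-allFin j) j∈T)
    where
    elements : List (Fin n)
    elements = filter (_∈? T) (allFin n)

⊤∈subsets : ∀ n → ⊤ ∈ₗ subsets n
⊤∈subsets zero    = here refl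
⊤∈subsets (suc n) = ∈-++⁺ʳ (map (outside Vec.∷_) (subsets n)) (∈-map⁺ (inside Vec.∷_) (⊤∈subsets n))

-- Witnessed by the full set. It makes `N` positive, which allows the division by `N` in `shift`.
nonemptySubsets-inhabited : ∀ n → Any (λ _ → Unit) (nonemptySubsets (suc n))
nonemptySubsets-inhabited n =
  Any.mapMaybe⁺ _ (subsets (suc n)) (Any.map⁺ (lose (⊤∈subsets (suc n)) found))
  where
  found : MAny.Any (λ _ → Unit)
    (Maybe.map {B = NonemptySubset (suc n)} (λ ne → ⊤ , fromWitness {a? = nonempty? ⊤} ne)
      (dec⇒maybe (nonempty? (⊤ {suc n}))))
  found with nonempty? (⊤ {suc n})
  ... | yes _ = just tt
  ... | no ¬ne = contradiction (zero , here) ¬ne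

-- Determinants

-- The code (j, k) stands for the ordered pair of distinct indices j, `punchIn j k`. The reversed
-- pair then has the code (`punchIn j k`, `pinch k j`).
pinch-punchIn : ∀ {n} (j : Fin (suc n)) (k : Fin n) → punchIn (punchIn j k) (pinch k j) ≡ j
pinch-punchIn zero    zero    = refl
pinch-punchIn zero    (suc k) = refl
pinch-punchIn (suc j) zero    = refl
pinch-punchIn (suc j) (suc k) = cong suc (pinch-punchIn j k)

-- Deleting two columns leaves the same minor whichever is deleted first.
punchIn-comm : ∀ {n} (j : Fin (suc (suc n))) (k : Fin (suc n)) (i : Fin n) →
               punchIn (punchIn j k) (punchIn (pinch k j) i) ≡ punchIn j (punchIn k i)
punchIn-comm zero    zero    i       = refl
punchIn-comm zero    (suc k) i       = refl
punchIn-comm (suc j) zero    i       = refl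
punchIn-comm (suc j) (suc k) zero    = refl
punchIn-comm (suc j) (suc k) (suc i) = cong suc (punchIn-comm j k i)

module Determinant {c ℓ} (K : OrderedField c ℓ) where
  open OrderedField K
  open Geometry K
  open Lemmas
  open SemiringSum semiring using (∑-distrib-+)
  open IntegerRingSolver K
  open ≡-Reasoning

  sign : ∀ {n} → Fin n → Carrier
  sign j = (- 1#) ^ toℕ j

  -- If k < j, the new code is (k, j - 1); otherwise it is (k + 1, j). Either way the sum of the two
  -- entries changes by one, so the parity flips.
  sign-punchIn-pinch : ∀ {n} (j : Fin (suc n)) (k : Fin n) →
                       sign (punchIn j k) * sign (pinch k j) ≡ - (sign j * sign k)
  sign-punchIn-pinch zero    zero    =
    solve 0 (:- con (+ 1) :* con (+ 1) :* con (+ 1) := :- (con (+ 1) :* con (+ 1))) refl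
  sign-punchIn-pinch zero    (suc k) =
    solve 1 (λ s → :- con (+ 1) :* s :* con (+ 1) := :- (con (+ 1) :* s)) refl (sign (suc k))
  sign-punchIn-pinch (suc j) zero    =
    solve 1 (λ s → con (+ 1) :* s := :- (:- con (+ 1) :* s :* con (+ 1))) refl (sign j)
  sign-punchIn-pinch (suc j) (suc k) = begin
    (- 1# * a) * (- 1# * b)  ≡⟨ cancel a b ⟩
    a * b                    ≡⟨ sign-punchIn-pinch j k ⟩
    - (x * y)                ≡⟨ cong -_ (cancel x y) ⟨
    - ((- 1# * x) * (- 1# * y)) ∎
    where
    a = sign (punchIn j k)
    b = sign (pinch k j)
    x = sign j
    y = sign k
    cancel : ∀ s t → (- 1# * s) * (- 1# * t) ≡ s * t
    cancel = solve 2 (λ s t → (:- con (+ 1) :* s) :* (:- con (+ 1) :* t) := s :* t) refl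

  -- Ordered pairs of distinct indices, listed by (first, position of the
  -- second among the others), are reindexed by exchanging the two entries.
  ∑-swap : ∀ n (f : Fin (suc n) → Fin n → Carrier) →
           ∑ (λ j → ∑ λ k → f j k) ≡ ∑ (λ j → ∑ λ k → f (punchIn j k) (pinch k j))
  ∑-swap zero    f = refl
  ∑-swap (suc n) f = begin
    -- `A` collects the pairs whose first index is zero and `B` those whose second is. Reversal
    -- exchanges the two, and the remaining pairs are handled by induction.
    A + ∑ (λ j → f (suc j) zero + ∑ λ k → f (suc j) (suc k))
      ≡⟨ cong (λ z → A + z) (∑-distrib-+ (λ j → f (suc j) zero) (λ j → ∑ λ k → f (suc j) (suc k))) ⟩
    A + (B + ∑ λ j → ∑ λ k → f (suc j) (suc k))
      ≡⟨ solve 3 (λ a b d → a :+ (b :+ d) := b :+ (a :+ d)) refl A B _ ⟩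
    B + (A + ∑ λ j → ∑ λ k → f (suc j) (suc k))
      ≡⟨ cong (λ z → B + (A + z)) (∑-swap n λ j k → f (suc j) (suc k)) ⟩
    B + (A + ∑ λ j → ∑ λ k → f (suc (punchIn j k)) (suc (pinch k j)))
      ≡⟨ cong (λ z → B + z) (∑-distrib-+ (f zero) (λ j → ∑ λ k → f (suc (punchIn j k)) (suc (pinch k j)))) ⟨
    B + ∑ (λ j → f zero j + ∑ λ k → f (suc (punchIn j k)) (suc (pinch k j))) ∎
    where
    A = ∑ (f zero)
    B = ∑ λ j → f (suc j) zero

  det-cong : ∀ {n} {A B : Fin n → Point n} → (∀ i k → A i k ≡ B i k) → det A ≡ det B
  det-cong {zero}  A≗B = refl
  det-cong {suc n} A≗B = sum-cong λ j →
    cong₂ (λ x y → sign j * x * y) (A≗B zero j) (det-cong λ i k → A≗B (suc i) (punchIn j k))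

  -- The row length r is left free, so that columns can be deleted before or after bordering; only r
  -- = m + 1 gives a square matrix.
  border : ∀ {m r} → (Fin m → Point r) → Fin (suc m) → Point r
  border {m} R = VecF.insertAt R (fromℕ m) 𝟏

  select : ∀ {m r s} → (Fin m → Point r) → (Fin s → Fin r) → Fin m → Point s
  select R p i k = R i (p k)

  border-select : ∀ {m r s} (R : Fin m → Point r) (p : Fin s → Fin r) i k →
                  border R i (p k) ≡ border (select R p) i k
  border-select {zero}  R p zero    k = refl
  border-select {suc m} R p zero    k = refl
  border-select {suc m} R p (suc i) k = border-select (R ∘ suc) p i k

  det-border : ∀ {m} (R : Fin (suc m) → Point (suc (suc m))) →
               det (border R) ≡
               ∑ λ j → sign j * R zero j * det (border (select (R ∘ suc) (punchIn j)))
  det-border R = sum-cong λ j → cong (λ z → sign j * R zero j * z)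
    (det-cong (border-select (R ∘ suc) (punchIn j)))

  -- Up to a scalar, the expansion along its first row of a determinant whose
  -- first and last rows are 𝟏.
  bordered-cofactors : ∀ {m} (R : Fin m → Point (suc (suc m))) →
                       ∑ (λ j → sign j * det (border (select R (punchIn j)))) ≡ 0#
  bordered-cofactors {zero} R =
    solve 1 (λ d → con (+ 1) :* d :+ ((:- con (+ 1) :* con (+ 1)) :* d :+ con (+ 0)) := con (+ 0))
      refl (det {1} (border {zero} λ ()))
  bordered-cofactors {suc m} R = begin
    ∑ (λ j → sign j * det (border (select R (punchIn j))))
      ≡⟨ sum-cong (λ j → trans (cong (λ z → sign j * z) (det-border (select R (punchIn j))))
                               (*-distribˡ-sum (sign j) λ k → sign k * R zero (punchIn j k) * D j k)) ⟩
    ∑ (λ j → ∑ λ k → f j k)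
      ≡⟨ ∑-swap _ f ⟩
    ∑ (λ j → ∑ λ k → f (punchIn j k) (pinch k j))
      -- After the exchange the entry of row zero depends on j alone. It leaves the inner sum, which
      -- is the same cofactor sum for one row fewer.
      ≡⟨ sum-cong (λ j → sum-cong λ k → swapped j k) ⟩
    ∑ (λ j → ∑ λ k → - (sign j * R zero j) * (sign k * D j k))
      ≡⟨ sum-zero (λ j → trans (sym (*-distribˡ-sum (- (sign j * R zero j)) λ k → sign k * D j k))
           (trans (cong (λ z → - (sign j * R zero j) * z)
                        (bordered-cofactors (select (R ∘ suc) (punchIn j))))
                  (zeroʳ _))) ⟩
    0# ∎
    where
    D : Fin (suc (suc (suc m))) → Fin (suc (suc m)) → Carrier
    D j k = det (border (select (select (R ∘ suc) (punchIn j)) (punchIn k)))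
    f : Fin (suc (suc (suc m))) → Fin (suc (suc m)) → Carrier
    f j k = sign j * (sign k * R zero (punchIn j k) * D j k)
    border-cong : ∀ {m r} {R S : Fin m → Point r} → (∀ i k → R i k ≡ S i k) →
                  ∀ i k → border R i k ≡ border S i k
    border-cong {zero}  R≗S zero    k = refl
    border-cong {suc m} R≗S zero    k = R≗S zero k
    border-cong {suc m} R≗S (suc i) k = border-cong (R≗S ∘ suc) i k
    swapped : ∀ j k → f (punchIn j k) (pinch k j) ≡ - (sign j * R zero j) * (sign k * D j k)
    swapped j k = begin
      sign j′ * (sign k′ * R zero (punchIn j′ k′) * D j′ k′)
        ≡⟨ cong₂ (λ x y → sign j′ * (sign k′ * x * y)) (cong (R zero) (pinch-punchIn j k))
             (det-cong (border-cong λ i l → cong (R (suc i)) (punchIn-comm j k l))) ⟩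
      sign j′ * (sign k′ * R zero j * D j k)
        ≡⟨ solve 4 (λ a b r d → a :* (b :* r :* d) := (a :* b) :* (r :* d)) refl _ _ _ _ ⟩
      (sign j′ * sign k′) * (R zero j * D j k)
        ≡⟨ cong (λ z → z * (R zero j * D j k)) (sign-punchIn-pinch j k) ⟩
      - (sign j * sign k) * (R zero j * D j k)
        ≡⟨ solve 4 (λ a b r d → :- (a :* b) :* (r :* d) := :- (a :* r) :* (b :* d)) refl _ _ _ _ ⟩
      - (sign j * R zero j) * (sign k * D j k) ∎
      where
      j′ = punchIn j k
      k′ = pinch k j

  -- Bordered determinants of flags

  IsSign : Carrier → Set c
  IsSign s = s ≡ 1# ⊎ s ≡ - 1#

  IsSign-neg : ∀ {s} → IsSign s → IsSign (- 1# * s)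
  IsSign-neg (inj₁ refl) = inj₂ (*-identityʳ _)
  IsSign-neg (inj₂ refl) = inj₁ (solve 0 (:- con (+ 1) :* :- con (+ 1) := con (+ 1)) refl)

  IsSign-sign* : ∀ {n} (j : Fin n) {s} → IsSign s → IsSign (sign j * s)
  IsSign-sign* zero    p = subst IsSign (sym (*-identityˡ _)) p
  IsSign-sign* (suc j) p = subst IsSign (sym (*-assoc _ _ _)) (IsSign-neg (IsSign-sign* j p))

  -- The rows are indicator vectors of growing segments, each shifted by a multiple of `𝟏`. In the
  -- expansion along the first row the shift contributes nothing, by `bordered-cofactors`, and the
  -- indicator of a single element leaves one minor. That minor is again of this kind, for σ with
  -- its first element removed.
  det-flag : ∀ {m} (σ : Permutation′ (suc m)) (R : Fin m → Point (suc m)) (d : Fin m → Carrier) →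
             (∀ {i j} → toℕ i ℕ.≤ toℕ j → R j (σ ⟨$⟩ʳ i) ≡ 1# - d j) →
             (∀ {i j} → toℕ j ℕ.< toℕ i → R j (σ ⟨$⟩ʳ i) ≡ 0# - d j) →
             IsSign (det (border R))
  det-flag {zero} σ R d in-segment off-segment =
    inj₁ (solve 0 (con (+ 1) :* con (+ 1) :* con (+ 1) :+ con (+ 0) := con (+ 1)) refl)
  det-flag {suc m} σ R d in-segment off-segment = subst IsSign (sym expand)
    (IsSign-sign* σ0 (det-flag (remove zero σ) (select (R ∘ suc) (punchIn σ0)) (d ∘ suc)
      (λ {i} {j} i≤j → trans (cong (R (suc j)) (sym (punchIn-permute σ zero i))) (in-segment (s≤s i≤j)))
      (λ {i} {j} j<i → trans (cong (R (suc j)) (sym (punchIn-permute σ zero i))) (off-segment (s≤s j<i)))))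
    where
    σ0 = σ ⟨$⟩ʳ zero
    D : Fin (suc (suc m)) → Carrier
    D j = det (border (select (R ∘ suc) (punchIn j)))
    first-row′ : ∀ i → R zero (σ ⟨$⟩ʳ i) ≡ δ σ0 (σ ⟨$⟩ʳ i) - d zero
    first-row′ zero    = trans (in-segment z≤n) (cong (λ z → z - d zero) (sym (δ-refl σ0)))
    first-row′ (suc i) = trans (off-segment (s≤s z≤n)) (cong (λ z → z - d zero)
      (sym (δ-≢ (Fin.0≢1+n ∘ permutation-injective σ))))
    first-row : ∀ k → R zero k ≡ δ σ0 k - d zero
    first-row k = subst (λ k → R zero k ≡ δ σ0 k - d zero) (inverseʳ σ) (first-row′ (σ ⟨$⟩ˡ k))
    expand : det (border R) ≡ sign σ0 * D σ0
    expand = begin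
      det (border R)
        ≡⟨ det-border R ⟩
      ∑ (λ j → sign j * R zero j * D j)
        ≡⟨ sum-cong (λ j → trans (cong (λ z → sign j * z * D j) (first-row j))
             (solve 4 (λ s x y z → s :* (x :- y) :* z := x :* (s :* z) :+ :- y :* (s :* z)) refl
                (sign j) (δ σ0 j) (d zero) (D j))) ⟩
      ∑ (λ j → δ σ0 j * (sign j * D j) + - d zero * (sign j * D j))
        ≡⟨ ∑-distrib-+ (λ j → δ σ0 j * (sign j * D j)) (λ j → - d zero * (sign j * D j)) ⟩
      ∑ (λ j → δ σ0 j * (sign j * D j)) + ∑ (λ j → - d zero * (sign j * D j))
        ≡⟨ cong₂ _+_ (∑δ* σ0 (λ j → sign j * D j))
             (trans (sym (*-distribˡ-sum (- d zero) (λ j → sign j * D j)))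
               (trans (cong (λ z → - d zero * z) (bordered-cofactors (R ∘ suc))) (zeroʳ _))) ⟩
      sign σ0 * D σ0 + 0#
        ≡⟨ +-identityʳ _ ⟩
      sign σ0 * D σ0 ∎

-- Ordered fields

module OrderedFieldProperties {c ℓ} (K : OrderedField c ℓ) where
  open OrderedField K
  open Geometry K using (module Lemmas)
  open Lemmas
  open IntegerRingSolver K
  open ≡-Reasoning

  x≤y⇒0≤y-x : ∀ {x y} → x ≤ y → 0# ≤ y - x
  x≤y⇒0≤y-x {x} {y} x≤y = subst (_≤ y - x) (-‿inverseʳ x) (+-monoˡ-≤ (- x) x≤y)

  0≤y-x⇒x≤y : ∀ {x y} → 0# ≤ y - x → x ≤ y
  0≤y-x⇒x≤y {x} {y} p = subst₂ _≤_ (+-identityˡ x)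
    (solve 2 (λ x y → y :- x :+ x := y) refl x y) (+-monoˡ-≤ x p)

  -- Trades an inequality for a known one with the same difference of sides, so that only a ring
  -- identity remains.
  ≤-by : ∀ {a b x y} → x ≤ y → y - x ≡ b - a → a ≤ b
  ≤-by x≤y eq = 0≤y-x⇒x≤y (subst (0# ≤_) eq (x≤y⇒0≤y-x x≤y))

  ¬1≤0 : ¬ (1# ≤ 0#)
  ¬1≤0 p = 0≢1 (≤-antisym 0≤1 p)

  +-positive : ∀ {x y} → 0# < x → 0# ≤ y → 0# < x + y
  +-positive {x} {y} (0≤x , 0≢x) 0≤y =
    ≤-trans 0≤x x≤x+y , λ 0≡x+y → 0≢x (≤-antisym 0≤x (subst (x ≤_) (sym 0≡x+y) x≤x+y))
    where
    x≤x+y : x ≤ x + y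
    x≤x+y = subst (_≤ x + y) (+-identityʳ x) (+-mono-≤ ≤-refl 0≤y)

  0<1 : 0# < 1#
  0<1 = 0≤1 , 0≢1

  x*x⁻¹*y : ∀ {x} y → x ≢ 0# → y * x ⁻¹ * x ≡ y
  x*x⁻¹*y {x} y x≢0 = begin
    y * x ⁻¹ * x    ≡⟨ solve 3 (λ x x⁻¹ y → y :* x⁻¹ :* x := y :* (x :* x⁻¹)) refl x (x ⁻¹) y ⟩
    y * (x * x ⁻¹)  ≡⟨ cong (y *_) (*-inverseʳ x x≢0) ⟩
    y * 1#          ≡⟨ *-identityʳ y ⟩
    y               ∎

  x*y≡0⇒x≡0 : ∀ {x y} → y ≢ 0# → x * y ≡ 0# → x ≡ 0#
  x*y≡0⇒x≡0 {x} {y} y≢0 xy≡0 = begin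
    x              ≡⟨ x*x⁻¹*y x y≢0 ⟨
    x * y ⁻¹ * y   ≡⟨ solve 3 (λ x y⁻¹ y → x :* y⁻¹ :* y := x :* y :* y⁻¹) refl x (y ⁻¹) y ⟩
    x * y * y ⁻¹   ≡⟨ cong (_* y ⁻¹) xy≡0 ⟩
    0# * y ⁻¹      ≡⟨ zeroˡ _ ⟩
    0#             ∎

  /-positive : ∀ {x y} → 0# < x → 0# < y → 0# < y * x ⁻¹
  /-positive {x} {y} (0≤x , 0≢x) (0≤y , 0≢y) = *-nonNegative 0≤y 0≤x⁻¹ , λ 0≡ → 0≢y
      (trans (sym (zeroˡ x)) (trans (cong (_* x) 0≡) (x*x⁻¹*y y (0≢x ∘ sym))))
    where
    0≤x⁻¹ : 0# ≤ x ⁻¹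
    0≤x⁻¹ with ≤-total 0# (x ⁻¹)
    ... | inj₁ p = p
    -- If `x ⁻¹` were at most 0, then x times its negative would be nonnegative; but that product is
    -- -1.
    ... | inj₂ p = contradiction
      (0≤y-x⇒x≤y (subst (0# ≤_)
        (trans (solve 2 (λ x y → x :* :- y := con (+ 0) :- x :* y) refl x (x ⁻¹))
               (cong (λ z → 0# - z) (*-inverseʳ x (0≢x ∘ sym))))
        (*-nonNegative 0≤x (subst (0# ≤_) (+-identityˡ _) (x≤y⇒0≤y-x p)))))
      ¬1≤0

  ∣x∣≡x : ∀ {x} → 0# ≤ x → ∣ x ∣ ≡ x
  ∣x∣≡x {x} 0≤x with 0# ≤? x
  ... | yes _   = refl
  ... | no  0≰x = contradiction 0≤x 0≰x

  ∣-x∣≡x : ∀ {x} → 0# ≤ x → ∣ - x ∣ ≡ x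
  ∣-x∣≡x {x} 0≤x with 0# ≤? - x
  ... | no  _    = solve 1 (λ x → :- :- x := x) refl x
  ... | yes 0≤-x = trans (cong -_ x≡0) (trans (solve 0 (:- con (+ 0) := con (+ 0)) refl) (sym x≡0))
    where
    x≡0 : x ≡ 0#
    x≡0 = ≤-antisym (≤-by 0≤-x (solve 1 (λ x → :- x :- con (+ 0) := con (+ 0) :- x) refl x)) 0≤x

  x≤∣x∣ : ∀ x → x ≤ ∣ x ∣
  x≤∣x∣ x with 0# ≤? x
  ... | yes _   = ≤-refl
  ... | no  0≰x with ≤-total 0# x
  ...   | inj₁ 0≤x = contradiction 0≤x 0≰x
  ...   | inj₂ x≤0 = ≤-trans x≤0 (≤-by x≤0 (solve 1 (λ x → con (+ 0) :- x := :- x :- con (+ 0)) refl x))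

  -x≤∣x∣ : ∀ x → - x ≤ ∣ x ∣
  -x≤∣x∣ x with 0# ≤? x
  ... | no  _   = ≤-refl
  ... | yes 0≤x = ≤-trans (≤-by 0≤x (solve 1 (λ x → x :- con (+ 0) := con (+ 0) :- :- x) refl x)) 0≤x

  -- Sums over lists

  module _ {a} {A : Set a} where

    ∑ₗ-cong : ∀ (as : List A) {f g : A → Carrier} → (∀ x → f x ≡ g x) → ∑ₗ as f ≡ ∑ₗ as g
    ∑ₗ-cong []       f≗g = refl
    ∑ₗ-cong (x ∷ as) f≗g = cong₂ _+_ (f≗g x) (∑ₗ-cong as f≗g)

    ∑ₗ-mono : ∀ (as : List A) {f g : A → Carrier} → (∀ x → f x ≤ g x) → ∑ₗ as f ≤ ∑ₗ as g
    ∑ₗ-mono []       f≤g = ≤-refl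
    ∑ₗ-mono (x ∷ as) f≤g = +-mono-≤ (f≤g x) (∑ₗ-mono as f≤g)

    ∑ₗ-+ : ∀ (as : List A) (f g : A → Carrier) → (∑[ x ∈ as ] (f x + g x)) ≡ ∑ₗ as f + ∑ₗ as g
    ∑ₗ-+ []       f g = sym (+-identityˡ 0#)
    ∑ₗ-+ (x ∷ as) f g = trans (cong (λ z → f x + g x + z) (∑ₗ-+ as f g))
      (solve 4 (λ a b u v → a :+ b :+ (u :+ v) := a :+ u :+ (b :+ v)) refl _ _ _ _)

    ∑ₗ-*ʳ : ∀ (as : List A) (f : A → Carrier) z → (∑[ x ∈ as ] (f x * z)) ≡ ∑ₗ as f * z
    ∑ₗ-*ʳ []       f z = sym (zeroˡ z)
    ∑ₗ-*ʳ (x ∷ as) f z = trans (cong (λ w → f x * z + w) (∑ₗ-*ʳ as f z)) (sym (distribʳ z _ _))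

    ∑ₗ-*ˡ : ∀ (as : List A) (f : A → Carrier) z → (∑[ x ∈ as ] (z * f x)) ≡ z * ∑ₗ as f
    ∑ₗ-*ˡ as f z = trans (∑ₗ-cong as λ x → *-comm z (f x)) (trans (∑ₗ-*ʳ as f z) (*-comm _ z))

    ∑ₗ-zero : ∀ (as : List A) → (∑[ x ∈ as ] 0#) ≡ 0#
    ∑ₗ-zero []       = refl
    ∑ₗ-zero (x ∷ as) = trans (+-identityˡ _) (∑ₗ-zero as)

    ∑-∑ₗ-comm : ∀ {n} (as : List A) (f : Fin n → A → Carrier) →
                ∑ (λ k → ∑ₗ as (f k)) ≡ (∑[ x ∈ as ] ∑ (λ k → f k x))
    ∑-∑ₗ-comm {zero}  as f = sym (∑ₗ-zero as)
    ∑-∑ₗ-comm {suc n} as f = trans (cong (λ z → ∑ₗ as (f zero) + z) (∑-∑ₗ-comm as (f ∘ suc)))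
      (sym (∑ₗ-+ as (f zero) (λ x → ∑ λ k → f (suc k) x)))

    ∑ₗ-lookup : ∀ (as : List A) (f : A → Carrier) → ∑ (λ i → f (lookup as i)) ≡ ∑ₗ as f
    ∑ₗ-lookup []       f = refl
    ∑ₗ-lookup (x ∷ as) f = cong (λ z → f x + z) (∑ₗ-lookup as f)

    ∑ₗ-filter : ∀ {p} {P : A → Set p} (P? : Decidable P) (as : List A) (f : A → Carrier) →
                ∑ₗ (filter P? as) f ≡ (∑[ x ∈ as ] (f x * (if does (P? x) then 1# else 0#)))
    ∑ₗ-filter P? []       f = refl
    ∑ₗ-filter P? (x ∷ as) f with P? x
    ... | yes _ = cong₂ _+_ (sym (*-identityʳ _)) (∑ₗ-filter P? as f)
    ... | no  _ = trans (∑ₗ-filter P? as f)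
      (sym (trans (cong (λ z → z + (∑[ x ∈ as ] (f x * (if does (P? x) then 1# else 0#))))
                        (zeroʳ (f x)))
                  (+-identityˡ _)))

    ∑ₗ-1-nonNegative : ∀ (as : List A) → 0# ≤ (∑[ x ∈ as ] 1#)
    ∑ₗ-1-nonNegative as = subst (_≤ (∑[ x ∈ as ] 1#)) (∑ₗ-zero as) (∑ₗ-mono as λ _ → 0≤1)

    ∑ₗ-1-positive : ∀ {p} {P : A → Set p} {as : List A} → Any P as → 0# < (∑[ x ∈ as ] 1#)
    ∑ₗ-1-positive {as = x ∷ as} _ = +-positive 0<1 (∑ₗ-1-nonNegative as)

-- The dual cone and its boundary

module MinimumSum {c ℓ} (K : OrderedField c ℓ) (m : ℕ) where
  open OrderedField K
  open Geometry K
  open Lemmas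
  open IntegerRingSolver K
  open OrderedFieldProperties K

  n : ℕ
  n = suc m

  Ts : List (NonemptySubset n)
  Ts = nonemptySubsets n

  N : Carrier
  N = ∑[ T ∈ Ts ] 1#

  0<N : 0# < N
  0<N = ∑ₗ-1-positive (nonemptySubsets-inhabited m)

  N≢0 : N ≢ 0#
  N≢0 = proj₂ 0<N ∘ sym

  min : NonemptySubset n → Point n → Carrier
  min T v = proj₁ (minimum (Δ T) v)

  pairing-basis : ∀ (v : Point n) i → ⟨ v , basis i ⟩ ≡ v i
  pairing-basis v i = trans (sum-cong λ k → *-comm (v k) (δ i k)) (∑δ* i v)

  min-attained : ∀ T v → ∃ λ i → i ∈ proj₁ T × min T v ≡ v i × (∀ {j} → j ∈ proj₁ T → v i ≤ v j)
  min-attained (T , ne) v with argmin T (toWitness ne) (λ i → ⟨ v , basis i ⟩)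
  ... | i , i∈T , lower = i , i∈T , pairing-basis v i ,
    λ {j} j∈T → subst₂ _≤_ (pairing-basis v i) (pairing-basis v j) (lower j j∈T)

  -- The minimising vertex that `minimum` selects may differ from i when there are ties;
  -- antisymmetry identifies the values.
  min-unique : ∀ T v {i} → i ∈ proj₁ T → (∀ {j} → j ∈ proj₁ T → v i ≤ v j) → min T v ≡ v i
  min-unique T v {i} i∈T lower with min-attained T v
  ... | i′ , i′∈T , eq , lower′ = trans eq (≤-antisym (lower′ i∈T) (lower i′∈T))

  -- The function g: the minimum of ⟨v, ·⟩ over the Minkowski sum of all the simplices.
  minSum : Point n → Carrier
  minSum v = ∑[ T ∈ Ts ] min T v

  -- Each of the `N` minima grows by at most t. This is the continuity estimate that locates the
  -- boundary.
  minSum-≤ : ∀ {u v t} → (∀ k → u k ≤ v k + t) → minSum u ≤ minSum v + N * t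
  minSum-≤ {u} {v} {t} u≤v+t = subst (minSum u ≤_)
    (trans (∑ₗ-+ Ts (λ T → min T v) (λ _ → t)) (cong (λ z → minSum v + z)
      (trans (∑ₗ-cong Ts λ _ → sym (*-identityˡ t)) (∑ₗ-*ʳ Ts (λ _ → 1#) t))))
    (∑ₗ-mono Ts min-≤)
    where
    min-≤ : ∀ T → min T u ≤ min T v + t
    min-≤ T with min-attained T u | min-attained T v
    ... | i , i∈ , eq , lower | j , j∈ , eq′ , _ rewrite eq | eq′ = ≤-trans (lower j∈) (u≤v+t j)

  minSum-shift : ∀ {u v t} → (∀ k → u k ≡ v k + t) → minSum u ≡ minSum v + N * t
  minSum-shift {u} {v} {t} u≡v+t = ≤-antisym (minSum-≤ (≤-reflexive ∘ u≡v+t))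
    (≤-by (minSum-≤ {v} {u} {t = - t} λ k → ≤-reflexive
             (trans (solve 2 (λ v t → v := v :+ t :- t) refl (v k) t) (cong (_- t) (sym (u≡v+t k)))))
          (solve 4 (λ g g′ N t → g′ :+ N :* :- t :- g := g′ :- (g :+ N :* t)) refl _ _ N t))

  C : PointSet n
  C = cone (minkowskiSum Ts Δ)

  pairing-∑ₗ : ∀ (v : Point n) (ys : NonemptySubset n → Point n) {y : Point n} →
               (∀ k → y k ≡ (∑[ T ∈ Ts ] ys T k)) → ⟨ v , y ⟩ ≡ (∑[ T ∈ Ts ] ⟨ v , ys T ⟩)
  pairing-∑ₗ v ys y≡ = trans
    (sum-cong λ k → trans (cong (v k *_) (y≡ k)) (sym (∑ₗ-*ˡ Ts (λ T → ys T k) (v k))))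
    (∑-∑ₗ-comm Ts λ k T → v k * ys T k)

  -- Adding up the minimising vertices of all the simplices gives a point of the cone whose pairing
  -- with v is g(v).
  dual⇒ : ∀ v → dual C v → 0# ≤ minSum v
  dual⇒ v v∈ = subst (0# ≤_)
    (trans (pairing-∑ₗ v ys λ _ → refl) (∑ₗ-cong Ts λ T → proj₂ (proj₂ (proj₁ (proj₂ (minimum (Δ T) v))))))
    (v∈ _ (1# , _ , 0≤1 , (ys , (λ T → proj₁ (proj₂ (proj₁ (proj₂ (minimum (Δ T) v))))) , λ _ → refl)
          , λ _ → sym (*-identityˡ _)))
    where
    ys : NonemptySubset n → Point n
    ys T = proj₁ (proj₁ (proj₂ (minimum (Δ T) v)))

  dual⇐ : ∀ v → 0# ≤ minSum v → dual C v
  dual⇐ v 0≤ y (t , y′ , 0≤t , (ys , ys∈ , y′≡) , y≡) = subst (0# ≤_)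
    (sym (trans (sum-cong λ k → trans (cong (v k *_) (y≡ k))
             (solve 3 (λ a b d → a :* (b :* d) := b :* (a :* d)) refl (v k) t (y′ k)))
           (sym (*-distribˡ-sum t λ k → v k * y′ k))))
    (*-nonNegative 0≤t (≤-trans 0≤ (subst (minSum v ≤_) (sym (pairing-∑ₗ v ys y′≡))
      (∑ₗ-mono Ts λ T → proj₂ (proj₂ (minimum (Δ T) v)) (ys T) (ys∈ T)))))

  -- The vector v itself lies in the dual cone, while v - η𝟏 lies outside, since g takes the value
  -- -Nη there. Taking η = ε/2 keeps the distance strictly below ε.
  boundary⇐ : ∀ v → minSum v ≡ 0# → ∂ (dual C) v
  boundary⇐ v g≡0 ε 0<ε@(0≤ε , 0≢ε) =
    (v , (λ k → subst (_< ε) (sym (trans (cong ∣_∣ (-‿inverseʳ (v k))) (∣x∣≡x ≤-refl))) 0<ε)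
       , dual⇐ v (≤-reflexive (sym g≡0))) ,
    ((λ k → v k - η)
       , (λ k → subst (_< ε) (sym (trans (cong ∣_∣ (solve 2 (λ v t → v :- t :- v := :- t) refl (v k) η))
                                         (∣-x∣≡x (proj₁ 0<η)))) η<ε)
       , λ v-η∈ → proj₂ 0<Nη (≤-antisym (proj₁ 0<Nη)
           (≤-by (dual⇒ (λ k → v k - η) v-η∈) (trans
              (cong (λ z → z - 0#) (minSum-shift {λ k → v k - η} {v} λ _ → refl))
              (trans (cong (λ z → z + N * - η - 0#) g≡0)
                (solve 2 (λ N t → con (+ 0) :+ N :* :- t :- con (+ 0) := con (+ 0) :- N :* t) refl N η))))))
    where
    0<2 : 0# < 1# + 1#
    0<2 = +-positive 0<1 0≤1
    η : Carrier
    η = ε * (1# + 1#) ⁻¹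
    0<η : 0# < η
    0<η = /-positive 0<2 0<ε
    η+η≡ε : η + η ≡ ε
    η+η≡ε = trans (solve 1 (λ t → t :+ t := t :* (con (+ 1) :+ con (+ 1))) refl η)
                  (x*x⁻¹*y ε (proj₂ 0<2 ∘ sym))
    η<ε : η < ε
    η<ε = ≤-by (proj₁ 0<η)
            (trans (solve 1 (λ t → t :- con (+ 0) := t :+ t :- t) refl η) (cong (_- η) η+η≡ε)) ,
          λ η≡ε → proj₂ 0<η (sym (trans (solve 1 (λ t → t := t :+ t :- t) refl η)
            (trans (cong (_- η) η+η≡ε) (trans (cong (λ z → ε - z) η≡ε) (-‿inverseʳ ε)))))
    0<Nη : 0# < N * η
    0<Nη = *-nonNegative (proj₁ 0<N) (proj₁ 0<η) ,
           λ 0≡ → N≢0 (x*y≡0⇒x≡0 (proj₂ 0<η ∘ sym) (sym 0≡))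

  0<N+1 : 0# < N + 1#
  0<N+1 = +-positive 0<N 0≤1

  -- If g(v) ≠ 0, put ε = ∣g(v)∣ / (N + 1). Moving every coordinate by less than ε changes g by at
  -- most Nε, which is less than ∣g(v)∣. So all points that near lie on the same side as v: inside
  -- when g(v) > 0, outside when g(v) < 0.
  boundary⇒ : ∀ v → ∂ (dual C) v → minSum v ≡ 0#
  boundary⇒ v v∈∂ with minSum v ≟ᴷ 0#
  ... | yes g≡0 = g≡0
  ... | no  g≢0 with ≤-total 0# (minSum v)
  ...   | inj₁ 0≤g = contradiction
    (dual⇐ y (≤-trans (proj₁ 0<ε) (≤-by (minSum-≤ {v} {y} λ k → v≤y+ε k) eq))) (proj₂ (proj₂ outer))
    where
    ε : Carrier
    ε = minSum v * (N + 1#) ⁻¹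
    0<ε : 0# < ε
    0<ε = /-positive 0<N+1 (0≤g , g≢0 ∘ sym)
    outer = proj₂ (v∈∂ ε 0<ε)
    y : Point n
    y = proj₁ outer
    v≤y+ε : ∀ k → v k ≤ y k + ε
    v≤y+ε k = ≤-by (≤-trans (-x≤∣x∣ _) (proj₁ (proj₁ (proj₂ outer) k)))
      (solve 3 (λ y v e → e :- :- (y :- v) := y :+ e :- v) refl (y k) (v k) ε)
    eq : minSum y + N * ε - minSum v ≡ minSum y - ε
    eq = trans (cong (λ z → minSum y + N * ε - z) (sym (x*x⁻¹*y (minSum v) (proj₂ 0<N+1 ∘ sym))))
      (solve 3 (λ g N e → g :+ N :* e :- e :* (N :+ con (+ 1)) := g :- e) refl (minSum y) N ε)
  ...   | inj₂ g≤0 = contradiction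
    (≤-antisym (proj₁ 0<ε)
      (≤-by (≤-trans (dual⇒ y (proj₂ (proj₂ inner))) (minSum-≤ {y} {v} λ k → y≤v+ε k)) eq))
    (proj₂ 0<ε)
    where
    0<-g : 0# < - minSum v
    0<-g = ≤-by g≤0 (solve 1 (λ g → con (+ 0) :- g := :- g :- con (+ 0)) refl (minSum v)) ,
      λ 0≡ → g≢0 (trans (solve 1 (λ g → g := :- :- g) refl (minSum v)) (trans (cong -_ (sym 0≡))
        (solve 0 (:- con (+ 0) := con (+ 0)) refl)))
    ε : Carrier
    ε = - minSum v * (N + 1#) ⁻¹
    0<ε : 0# < ε
    0<ε = /-positive 0<N+1 0<-g
    inner = proj₁ (v∈∂ ε 0<ε)
    y : Point n
    y = proj₁ inner
    y≤v+ε : ∀ k → y k ≤ v k + ε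
    y≤v+ε k = ≤-by (≤-trans (x≤∣x∣ _) (proj₁ (proj₁ (proj₂ inner) k)))
      (solve 3 (λ y v e → e :- (y :- v) := v :+ e :- y) refl (y k) (v k) ε)
    eq : minSum v + N * ε - 0# ≡ 0# - ε
    eq = trans (solve 3 (λ g N e → g :+ N :* e :- con (+ 0) := e :* (N :+ con (+ 1)) :- :- g :- e) refl
                  (minSum v) N ε)
      (cong (_- ε) (trans (cong (_- - minSum v) (x*x⁻¹*y (- minSum v) (proj₂ 0<N+1 ∘ sym)))
                          (-‿inverseʳ _)))

-- The braid fan triangulates the boundary

module Chambers {c ℓ} (K : OrderedField c ℓ) (m : ℕ) where
  open OrderedField K
  open Geometry K
  open Lemmas
  open SemiringSum semiring using (∑-distrib-+)
  open IntegerRingSolver K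
  open OrderedFieldProperties K
  open MinimumSum K m

  -- Sorting the coordinates of a vector

  Antitone : ∀ {r} → (Fin r → Carrier) → Set ℓ
  Antitone u = ∀ {i j} → i Fin.≤ j → u j ≤ u i

  antitone-by-steps : ∀ {r} (u : Fin (suc r) → Carrier) →
                      (∀ j → u (suc j) ≤ u (inject₁ j)) → Antitone u
  antitone-by-steps         u step {zero}  {zero}  _         = ≤-refl
  antitone-by-steps {suc r} u step {zero}  {suc j} _         =
    ≤-trans (antitone-by-steps (u ∘ suc) (step ∘ suc) {zero} {j} z≤n) (step zero)
  antitone-by-steps {suc r} u step {suc i} {suc j} (s≤s i≤j) =
    antitone-by-steps (u ∘ suc) (step ∘ suc) i≤j

  constant-by-steps : ∀ {r} (u : Fin (suc r) → Carrier) →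
                      (∀ j → u (suc j) ≡ u (inject₁ j)) → ∀ i → u i ≡ u zero
  constant-by-steps         u step zero    = refl
  constant-by-steps {suc r} u step (suc i) =
    trans (constant-by-steps (u ∘ suc) (step ∘ suc) i) (step zero)

  totalOrder : TotalOrder c c ℓ
  totalOrder = record { isTotalOrder = IsDecTotalOrder.isTotalOrder isDecTotalOrder }

  -- Selection sort: a largest coordinate goes first and the others are sorted recursively. The
  -- position found in the enumeration later serves as the index of a cone containing v.
  sorting-permutation : ∀ r (v : Fin r → Carrier) →
                        Any (λ σ → Antitone (λ i → v (σ ⟨$⟩ʳ i))) (permutations r)
  sorting-permutation zero    v = here λ { {()} }
  sorting-permutation (suc r) v with maximiser totalOrder ⊤ (zero , here) v
  ... | i₀ , _ , max = permutations-complete i₀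
    (Any.map (λ {π} → extend π) (sorting-permutation r (v ∘ punchIn i₀)))
    where
    extend : ∀ π → Antitone (λ i → v (punchIn i₀ (π ⟨$⟩ʳ i))) →
             Antitone (λ i → v (insert zero i₀ π ⟨$⟩ʳ i))
    extend π anti {zero}  {j}     _         = max ∈⊤
    extend π anti {suc i} {suc j} (s≤s i≤j) = anti i≤j

  InChamber : Permutation′ n → Point n → Set ℓ
  InChamber σ v = Antitone (λ i → v (σ ⟨$⟩ʳ i))

  -- Otherwise the elements that τ puts at positions 0 to i all have values above v(σ(i)), so σ puts
  -- each of them before position i. That injects i + 1 elements into i places.
  rearrangement-≤ : ∀ σ τ v → InChamber σ v → InChamber τ v → ∀ i → v (τ ⟨$⟩ʳ i) ≤ v (σ ⟨$⟩ʳ i)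
  rearrangement-≤ σ τ v v∈σ v∈τ i with v (τ ⟨$⟩ʳ i) ≤? v (σ ⟨$⟩ʳ i)
  ... | yes p = p
  ... | no ¬p with pigeonhole ℕ.≤-refl (λ k → fromℕ< (before k))
    where
    index : Fin (suc (toℕ i)) → Fin n
    index k = fromℕ< (ℕ.≤-trans (toℕ<n k) (toℕ<n i))
    index≤i : ∀ k → index k Fin.≤ i
    index≤i k = subst (ℕ._≤ toℕ i) (sym (toℕ-fromℕ< _)) (ℕ.s≤s⁻¹ (toℕ<n k))
    before : ∀ k → toℕ (σ ⟨$⟩ˡ (τ ⟨$⟩ʳ index k)) ℕ.< toℕ i
    before k with toℕ (σ ⟨$⟩ˡ (τ ⟨$⟩ʳ index k)) ℕ.<? toℕ i
    ... | yes q = q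
    ... | no ¬q = contradiction
      (≤-trans (v∈τ (index≤i k))
               (subst (λ z → v z ≤ v (σ ⟨$⟩ʳ i)) (inverseʳ σ) (v∈σ (ℕ.≮⇒≥ ¬q)))) ¬p
  ... | k , l , k<l , eq = contradiction
    (trans (sym (toℕ-fromℕ< _)) (trans (cong toℕ
      (permutation-injective τ (permutation-injective (Perm.flip σ)
        (toℕ-injective (trans (sym (toℕ-fromℕ< _)) (trans (cong toℕ eq) (toℕ-fromℕ< _)))))))
      (toℕ-fromℕ< _)))
    (ℕ.<⇒≢ k<l)

  rearrangement-≡ : ∀ σ τ v → InChamber σ v → InChamber τ v → ∀ i → v (σ ⟨$⟩ʳ i) ≡ v (τ ⟨$⟩ʳ i)
  rearrangement-≡ σ τ v v∈σ v∈τ i =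
    ≤-antisym (rearrangement-≤ τ σ v v∈τ v∈σ i) (rearrangement-≤ σ τ v v∈σ v∈τ i)

  -- Rays of the chambers

  χ : Subset n → Point n
  χ B k = if does (k ∈? B) then 1# else 0#

  χ-∈ : ∀ {B k} → k ∈ B → χ B k ≡ 1#
  χ-∈ {B} {k} k∈B = cong (if_then 1# else 0#) (dec-true (k ∈? B) k∈B)

  χ-∉ : ∀ {B k} → k ∉ B → χ B k ≡ 0#
  χ-∉ {B} {k} k∉B = cong (if_then 1# else 0#) (dec-false (k ∈? B) k∉B)

  shift : Subset n → Carrier
  shift B = minSum (χ B) * N ⁻¹

  ray : Subset n → Point n
  ray B k = χ B k - shift B

  minSum-ray : ∀ B → minSum (ray B) ≡ 0#
  minSum-ray B = trans (minSum-shift {ray B} {χ B} λ _ → refl)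
    (trans (solve 3 (λ g N d → g :+ N :* :- d := g :- d :* N) refl (minSum (χ B)) N (shift B))
      (trans (cong (λ z → minSum (χ B) - z) (x*x⁻¹*y (minSum (χ B)) N≢0)) (-‿inverseʳ _)))

  -- Since j counts from 0, it stands for a = j + 1; the segments are the nonempty proper initial
  -- ones.
  segment : Permutation′ n → Fin m → Subset n
  segment σ j = initialSegment σ (suc (toℕ j))

  rays : Permutation′ n → Fin m → Point n
  rays σ j = ray (segment σ j)

  χ-segment-≤ : ∀ σ {i j} → toℕ i ℕ.≤ toℕ j → χ (segment σ j) (σ ⟨$⟩ʳ i) ≡ 1#
  χ-segment-≤ σ i≤j = χ-∈ (∈-initialSegment⁺ σ (s≤s i≤j))

  χ-segment-> : ∀ σ {i j} → toℕ j ℕ.< toℕ i → χ (segment σ j) (σ ⟨$⟩ʳ i) ≡ 0#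
  χ-segment-> σ j<i = χ-∉ λ i∈ → ℕ.<⇒≱ j<i (ℕ.s≤s⁻¹ (∈-initialSegment⁻ σ i∈))

  -- Along σ an indicator of an initial segment drops once, by 1, where the segment ends.
  χ-segment-step : ∀ σ i j → χ (segment σ i) (σ ⟨$⟩ʳ inject₁ j) ≡
                             χ (segment σ i) (σ ⟨$⟩ʳ suc j) + δ j i
  χ-segment-step σ i j with Fin.<-cmp j i
  ... | tri< j<i j≢i _ = trans (χ-segment-≤ σ {inject₁ j} {i}
      (subst (ℕ._≤ toℕ i) (sym (toℕ-inject₁ j)) (ℕ.<⇒≤ j<i)))
    (sym (trans (cong₂ _+_ (χ-segment-≤ σ {suc j} {i} j<i) (δ-≢ j≢i)) (+-identityʳ _)))
  ... | tri≈ _ refl _  = trans (χ-segment-≤ σ {inject₁ j} {j} (ℕ.≤-reflexive (toℕ-inject₁ j)))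
    (sym (trans (cong₂ _+_ (χ-segment-> σ {suc j} {j} ℕ.≤-refl) (δ-refl j)) (+-identityˡ _)))
  ... | tri> _ j≢i i<j = trans (χ-segment-> σ {inject₁ j} {i}
      (subst (toℕ i ℕ.<_) (sym (toℕ-inject₁ j)) i<j))
    (sym (trans (cong₂ _+_ (χ-segment-> σ {suc j} {i} (ℕ.m<n⇒m<1+n i<j)) (δ-≢ j≢i)) (+-identityˡ _)))

  rays-step : ∀ σ i j → rays σ i (σ ⟨$⟩ʳ inject₁ j) ≡ rays σ i (σ ⟨$⟩ʳ suc j) + δ j i
  rays-step σ i j = trans (cong (_- shift (segment σ i)) (χ-segment-step σ i j))
    (solve 3 (λ x d e → x :+ d :- e := x :- e :+ d) refl
      (χ (segment σ i) (σ ⟨$⟩ʳ suc j)) (δ j i) (shift (segment σ i)))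

  -- Coefficients are read off as drops between consecutive coordinates along σ. Linear
  -- independence, membership in the chamber and the coordinates of a given vector all come from
  -- this identity.
  combination-step : ∀ σ w j → combination w (rays σ) (σ ⟨$⟩ʳ inject₁ j) ≡
                               combination w (rays σ) (σ ⟨$⟩ʳ suc j) + w j
  combination-step σ w j = trans
    (sum-cong λ i → trans (cong (w i *_) (rays-step σ i j))
      (solve 3 (λ w x d → w :* (x :+ d) := w :* x :+ d :* w) refl _ _ _))
    (trans (∑-distrib-+ (λ i → w i * rays σ i (σ ⟨$⟩ʳ suc j)) (λ i → δ j i * w i))
      (cong (λ z → combination w (rays σ) (σ ⟨$⟩ʳ suc j) + z) (∑δ* j w)))

  step⇒≤ : ∀ {x y w} → 0# ≤ w → x ≡ y + w → y ≤ x
  step⇒≤ {x} {y} {w} 0≤w eq = ≤-by 0≤w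
    (trans (solve 2 (λ y w → w :- con (+ 0) := y :+ w :- y) refl y w) (cong (_- y) (sym eq)))

  rays-inChamber : ∀ σ j → InChamber σ (rays σ j)
  rays-inChamber σ i = antitone-by-steps _ λ j → step⇒≤ (0≤δ j i) (rays-step σ i j)

  -- Linearity of g on a chamber

  lastElement : ∀ (σ : Permutation′ n) ((T , _) : NonemptySubset n) →
                ∃ λ i → i ∈ T × (∀ {j} → j ∈ T → toℕ (σ ⟨$⟩ˡ j) ℕ.≤ toℕ (σ ⟨$⟩ˡ i))
  lastElement σ (T , ne) = maximiser ℕ.≤-totalOrder T (toWitness ne) (λ i → toℕ (σ ⟨$⟩ˡ i))

  last : Permutation′ n → NonemptySubset n → Fin n
  last σ T = proj₁ (lastElement σ T)

  last∈ : ∀ σ T → last σ T ∈ proj₁ T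
  last∈ σ T = proj₁ (proj₂ (lastElement σ T))

  last-max : ∀ σ T {i} → i ∈ proj₁ T → toℕ (σ ⟨$⟩ˡ i) ℕ.≤ toℕ (σ ⟨$⟩ˡ last σ T)
  last-max σ T = proj₂ (proj₂ (lastElement σ T))

  min-inChamber : ∀ σ v T → InChamber σ v → min T v ≡ v (last σ T)
  min-inChamber σ v T v∈σ = min-unique T v (last∈ σ T) λ i∈T →
    subst₂ _≤_ (cong v (inverseʳ σ)) (cong v (inverseʳ σ)) (v∈σ (last-max σ T i∈T))

  minSum-inChamber : ∀ σ v → InChamber σ v → minSum v ≡ (∑[ T ∈ Ts ] v (last σ T))
  minSum-inChamber σ v v∈σ = ∑ₗ-cong Ts λ T → min-inChamber σ v T v∈σ

  combination-inChamber : ∀ σ w → (∀ j → 0# ≤ w j) → InChamber σ (combination w (rays σ))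
  combination-inChamber σ w 0≤w = antitone-by-steps _ λ j → step⇒≤ (0≤w j) (combination-step σ w j)

  -- Nonnegative weights keep the combination in the chamber, where g agrees with the linear form
  -- that sums v(`last σ T`) over T. That form vanishes on every ray.
  minSum-combination : ∀ σ w → (∀ j → 0# ≤ w j) → minSum (combination w (rays σ)) ≡ 0#
  minSum-combination σ w 0≤w = trans
    (minSum-inChamber σ (combination w (rays σ)) (combination-inChamber σ w 0≤w))
    (trans (sym (∑-∑ₗ-comm Ts λ j T → w j * rays σ j (last σ T)))
      (sum-zero λ j → trans (∑ₗ-*ˡ Ts (λ T → rays σ j (last σ T)) (w j))
        (trans (cong (w j *_) (trans (sym (minSum-inChamber σ (rays σ j) (rays-inChamber σ j)))
                                     (minSum-ray (segment σ j))))
               (zeroʳ (w j)))))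

  inChamber-resp : ∀ σ (u v : Point n) → u ≗ v → InChamber σ u → InChamber σ v
  inChamber-resp σ u v u≗v u∈σ i≤j = subst₂ _≤_ (u≗v _) (u≗v _) (u∈σ i≤j)

  span⇒inChamber : ∀ σ v → span (rays σ) v → InChamber σ v
  span⇒inChamber σ v (w , (0≤w , _) , v≗) =
    inChamber-resp σ (combination w (rays σ)) v (sym ∘ v≗) (combination-inChamber σ w 0≤w)

  minSum-cong : ∀ (u v : Point n) → u ≗ v → minSum u ≡ minSum v
  minSum-cong u v u≗v = trans
    (minSum-shift {u} {v} {0#} λ k → trans (u≗v k) (sym (+-identityʳ _)))
    (trans (cong (λ z → minSum v + z) (zeroʳ N)) (+-identityʳ _))

  span⇒minSum : ∀ σ v → span (rays σ) v → minSum v ≡ 0#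
  span⇒minSum σ v (w , (0≤w , _) , v≗) =
    trans (minSum-cong v (combination w (rays σ)) v≗) (minSum-combination σ w 0≤w)

  drop : Permutation′ n → Point n → Fin m → Carrier
  drop σ v j = v (σ ⟨$⟩ʳ inject₁ j) - v (σ ⟨$⟩ʳ suc j)

  0≤drop : ∀ σ v → InChamber σ v → ∀ j → 0# ≤ drop σ v j
  0≤drop σ v v∈σ j = x≤y⇒0≤y-x (v∈σ (ℕ.≤-trans (ℕ.≤-reflexive (toℕ-inject₁ j)) (ℕ.n≤1+n _)))

  -- Both sides have the same drops along σ, so they differ by t𝟏 for some t. As g vanishes on both,
  -- Nt = 0.
  inChamber⇒combination : ∀ σ v → InChamber σ v → minSum v ≡ 0# →
                          v ≗ combination (drop σ v) (rays σ)
  inChamber⇒combination σ v v∈σ g≡0 k =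
    trans (v≡v′+t k) (trans (cong (λ z → v′ k + z) t≡0) (+-identityʳ _))
    where
    v′ : Point n
    v′ = combination (drop σ v) (rays σ)
    t : Carrier
    t = v (σ ⟨$⟩ʳ zero) - v′ (σ ⟨$⟩ʳ zero)
    difference : ∀ i → v (σ ⟨$⟩ʳ i) - v′ (σ ⟨$⟩ʳ i) ≡ t
    difference = constant-by-steps _ λ j → sym (trans
      (cong (λ z → v (σ ⟨$⟩ʳ inject₁ j) - z) (combination-step σ (drop σ v) j))
      (solve 3 (λ x y z → x :- (z :+ (x :- y)) := y :- z) refl
        (v (σ ⟨$⟩ʳ inject₁ j)) (v (σ ⟨$⟩ʳ suc j)) (v′ (σ ⟨$⟩ʳ suc j))))
    v≡v′+t : ∀ k → v k ≡ v′ k + t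
    v≡v′+t k = trans (solve 2 (λ x y → x := y :+ (x :- y)) refl (v k) (v′ k))
      (cong (λ z → v′ k + z)
        (subst (λ k → v k - v′ k ≡ t) (inverseʳ σ) (difference (σ ⟨$⟩ˡ k))))
    t≡0 : t ≡ 0#
    t≡0 = x*y≡0⇒x≡0 N≢0 (trans (*-comm t N) (sym (trans (sym g≡0) (trans (minSum-shift v≡v′+t)
      (trans (cong (_+ N * t) (minSum-combination σ _ (0≤drop σ v v∈σ))) (+-identityˡ _))))))

  inChamber⇒span : ∀ σ v → InChamber σ v → minSum v ≡ 0# → span (rays σ) v
  inChamber⇒span σ v v∈σ g≡0 =
    drop σ v , (0≤drop σ v v∈σ , λ j j∉⊤ → contradiction ∈⊤ j∉⊤) , inChamber⇒combination σ v v∈σ g≡0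

  rays-independent : ∀ σ → LinearlyIndependent (rays σ)
  rays-independent σ w comb≗0 j = trans (sym (+-identityˡ _))
    (trans (cong (_+ w j) (sym (comb≗0 (σ ⟨$⟩ʳ suc j))))
      (trans (sym (combination-step σ w j)) (comb≗0 (σ ⟨$⟩ʳ inject₁ j))))

  -- The sum u of the rays of σ is an interior point: its coordinates fall by exactly 1 at each step
  -- along σ. A vector with distinct coordinates is sorted by one permutation only.
  span-injective : ∀ σ τ → (∀ {v} → span (rays σ) v → span (rays τ) v) → σ Perm.≈ τ
  span-injective σ τ σ⊆τ i = trans (cong (σ ⟨$⟩ʳ_) i≡) (inverseʳ σ)
    where
    u : Point n
    u = combination (λ _ → 1#) (rays σ)
    u∈σ : InChamber σ u
    u∈σ = combination-inChamber σ (λ _ → 1#) (λ _ → 0≤1)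
    u∈τ : InChamber τ u
    u∈τ = span⇒inChamber τ u
      (σ⊆τ ((λ _ → 1#) , ((λ _ → 0≤1) , λ j j∉⊤ → contradiction ∈⊤ j∉⊤) , λ _ → refl))
    strict : ∀ {i j} → i Fin.< j → u (σ ⟨$⟩ʳ i) ≢ u (σ ⟨$⟩ʳ j)
    strict {i} {j} i<j eq = ¬1≤0 (≤-by
      (u∈σ {suc i′} {j} (subst (ℕ._< toℕ j) (sym (Fin.toℕ-lower₁ i m≢i)) i<j))
      (trans (cong (λ z → u (σ ⟨$⟩ʳ suc i′) - z) (trans (sym eq) (trans
          (cong (λ i → u (σ ⟨$⟩ʳ i)) (sym (inject₁-lower₁ i m≢i)))
          (combination-step σ (λ _ → 1#) i′))))
        (solve 1 (λ x → x :- (x :+ con (+ 1)) := con (+ 0) :- con (+ 1)) refl _)))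
      where
      -- Lying below j, the position i is not the last one, so it has the form `inject₁ i′` and the
      -- step formula applies.
      m≢i : m ≢ toℕ i
      m≢i m≡i = ℕ.<⇒≱ (toℕ<n j) (subst (λ z → suc z ℕ.≤ toℕ j) (sym m≡i) i<j)
      i′ : Fin m
      i′ = lower₁ i m≢i
    i≡ : i ≡ σ ⟨$⟩ˡ (τ ⟨$⟩ʳ i)
    i≡ with Fin.<-cmp i (σ ⟨$⟩ˡ (τ ⟨$⟩ʳ i))
    ... | tri≈ _ eq _  = eq
    ... | tri< i< _ _  = contradiction
      (trans (rearrangement-≡ σ τ u u∈σ u∈τ i) (cong u (sym (inverseʳ σ)))) (strict i<)
    ... | tri> _ _ <i  = contradiction
      (trans (cong u (inverseʳ σ)) (sym (rearrangement-≡ σ τ u u∈σ u∈τ i))) (strict <i)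

  -- An element of the segment of σ has value at least v(σ(j)). Outside the segment of τ its value
  -- is at most v(τ(j + 1)) = v(σ(j + 1)), which contradicts the strict drop at j.
  segment-⊆ : ∀ σ τ v → InChamber σ v → InChamber τ v → ∀ j →
              v (σ ⟨$⟩ʳ inject₁ j) ≢ v (σ ⟨$⟩ʳ suc j) → ∀ {k} → k ∈ segment σ j → k ∈ segment τ j
  segment-⊆ σ τ v v∈σ v∈τ j v≢ {k} k∈ with toℕ (τ ⟨$⟩ˡ k) ℕ.≤? toℕ j
  ... | yes p = subst (_∈ segment τ j) (inverseʳ τ) (∈-initialSegment⁺ τ (s≤s p))
  ... | no ¬p = contradiction (≤-antisym
    (≤-trans upper (subst (v k ≤_) (sym (rearrangement-≡ σ τ v v∈σ v∈τ (suc j))) lower))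
    (v∈σ (ℕ.≤-trans (ℕ.≤-reflexive (toℕ-inject₁ j)) (ℕ.n≤1+n _)))) v≢
    where
    lower : v k ≤ v (τ ⟨$⟩ʳ suc j)
    lower = subst (λ k → v k ≤ v (τ ⟨$⟩ʳ suc j)) (inverseʳ τ) (v∈τ (ℕ.≰⇒> ¬p))
    upper : v (σ ⟨$⟩ʳ inject₁ j) ≤ v k
    upper = subst (λ k → v (σ ⟨$⟩ʳ inject₁ j) ≤ v k) (inverseʳ σ)
      (v∈σ (subst (toℕ (σ ⟨$⟩ˡ k) ℕ.≤_) (sym (toℕ-inject₁ j))
        (ℕ.s≤s⁻¹ (∈-initialSegment⁻ σ (subst (_∈ segment σ j) (sym (inverseʳ σ)) k∈)))))

  segment-≡ : ∀ σ τ v → InChamber σ v → InChamber τ v → ∀ j →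
              v (σ ⟨$⟩ʳ inject₁ j) ≢ v (σ ⟨$⟩ʳ suc j) → segment σ j ≡ segment τ j
  segment-≡ σ τ v v∈σ v∈τ j v≢ = ⊆-antisym
    (segment-⊆ σ τ v v∈σ v∈τ j v≢)
    (segment-⊆ τ σ v v∈τ v∈σ j λ eq → v≢ (trans (rearrangement-≡ σ τ v v∈σ v∈τ (inject₁ j))
      (trans eq (sym (rearrangement-≡ σ τ v v∈σ v∈τ (suc j))))))

  _≟ˢ_ : DecidableEquality (Subset n)
  _≟ˢ_ = ≡-dec Bool._≟_

  -- Comparing at equal positions finds every shared segment, because the segment at position j has
  -- j + 1 elements.
  common : Permutation′ n → Permutation′ n → Subset m
  common σ τ = Vec.tabulate λ j → does (segment σ j ≟ˢ segment τ j)

  ∈-common⁺ : ∀ {σ τ j} → segment σ j ≡ segment τ j → j ∈ common σ τ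
  ∈-common⁺ {σ} {τ} {j} eq = lookup⇒[]= j (common σ τ)
    (trans (lookup∘tabulate _ j) (dec-true (segment σ j ≟ˢ segment τ j) eq))

  ∈-common⁻ : ∀ {σ τ j} → j ∈ common σ τ → segment σ j ≡ segment τ j
  ∈-common⁻ {σ} {τ} {j} j∈ with segment σ j ≟ˢ segment τ j
                            | trans (sym (lookup∘tabulate
                                       (λ j → does (segment σ j ≟ˢ segment τ j)) j))
                                    ([]=⇒lookup j∈)
  ... | yes eq | _  = eq
  ... | no _   | ()

  -- For v in both cones a nonzero drop at j makes the two segments at j equal, so the weights live
  -- on the shared rays. Conversely, weights on shared rays describe the same vector in either cone.
  span-∩ : ∀ σ τ → (span (rays σ) ∩ span (rays τ)) ≐ span≥0 (common σ τ) (rays σ)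
  span-∩ σ τ = to , from
    where
    to : ∀ {v} → (span (rays σ) ∩ span (rays τ)) v → span≥0 (common σ τ) (rays σ) v
    to {v} (v∈spanσ , v∈spanτ) = drop σ v , (0≤drop σ v v∈σ , drop≡0) ,
      inChamber⇒combination σ v v∈σ (span⇒minSum σ v v∈spanσ)
      where
      v∈σ : InChamber σ v
      v∈σ = span⇒inChamber σ v v∈spanσ
      drop≡0 : ∀ j → j ∉ common σ τ → drop σ v j ≡ 0#
      drop≡0 j j∉ with v (σ ⟨$⟩ʳ inject₁ j) ≟ᴷ v (σ ⟨$⟩ʳ suc j)
      ... | yes eq = trans (cong (_- v (σ ⟨$⟩ʳ suc j)) eq) (-‿inverseʳ _)
      ... | no v≢  = contradiction
        (∈-common⁺ {σ} {τ} (segment-≡ σ τ v v∈σ (span⇒inChamber τ v v∈spanτ) j v≢)) j∉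
    from : ∀ {v} → span≥0 (common σ τ) (rays σ) v → (span (rays σ) ∩ span (rays τ)) v
    from {v} (w , (0≤w , w≡0) , v≗) =
      (w , (0≤w , λ j j∉⊤ → contradiction ∈⊤ j∉⊤) , v≗) ,
      (w , (0≤w , λ j j∉⊤ → contradiction ∈⊤ j∉⊤) , λ k → trans (v≗ k) (sum-cong λ j → term j k))
      where
      term : ∀ j k → w j * rays σ j k ≡ w j * rays τ j k
      term j k with j ∈? common σ τ
      ... | yes j∈ = cong (λ B → w j * ray B k) (∈-common⁻ {σ} {τ} j∈)
      ... | no  j∉ rewrite w≡0 j j∉ = trans (zeroˡ _) (sym (zeroˡ _))

  permutation : Fin (length (permutations n)) → Permutation′ n
  permutation = lookup (permutations n)

  fan : Fin (length (permutations n)) → Fin m → Point n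
  fan a = rays (permutation a)

  fan-isTriangulation : IsTriangulation (∂ (dual C)) fan
  fan-isTriangulation = record
    { simplicial = λ a → rays-independent (permutation a)
    ; covers     = λ v → mk⇔
        (λ v∈∂ → let p = sorting-permutation n v in
           Any.index p ,
           inChamber⇒span (permutation (Any.index p)) v (Any.lookup-index p) (boundary⇒ v v∈∂))
        (λ { (a , v∈a) → boundary⇐ v (span⇒minSum (permutation a) v v∈a) })
    ; distinct   = λ a b a≐b →
        lookup-injective {R = Perm._≈_} (λ σ≈τ i → sym (σ≈τ i)) (permutations-distinct n) a b
          (span-injective (permutation a) (permutation b) (proj₁ a≐b))
    ; commonFace = λ a b → let σ = permutation a ; τ = permutation b in
        common σ τ , common τ σ , span-∩ σ τ ,
        ((λ { (p , q) → proj₁ (span-∩ τ σ) (q , p) }) ,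
         λ p → let q = proj₂ (span-∩ τ σ) p in proj₂ q , proj₁ q)
    }

-- The dual volume of the fan

module Evaluation {c ℓ} (K : OrderedField c ℓ) (m : ℕ) where
  open OrderedField K
  open Geometry K
  open Lemmas
  open IntegerRingSolver K
  open OrderedFieldProperties K
  open MinimumSum K m
  open Chambers K m
  open Determinant K using (det-flag; border)

  ∣det-rays∣ : ∀ σ → ∣ det (VecF.insertAt (rays σ) (fromℕ m) 𝟏) ∣ ≡ 1#
  ∣det-rays∣ σ with det-flag σ (rays σ) (shift ∘ segment σ)
      (λ {i} {j} i≤j → cong (_- shift (segment σ j)) (χ-segment-≤ σ {i} {j} i≤j))
      (λ {i} {j} j<i → cong (_- shift (segment σ j)) (χ-segment-> σ {i} {j} j<i))
  ... | inj₁ eq = trans (cong ∣_∣ eq) (∣x∣≡x 0≤1)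
  ... | inj₂ eq = trans (cong ∣_∣ eq) (∣-x∣≡x 0≤1)

  -- A set is contained in an initial segment exactly when its last element under σ is.
  χ-last : ∀ σ j T → χ (segment σ j) (last σ T) ≡ (if does (proj₁ T ⊆? segment σ j) then 1# else 0#)
  χ-last σ j T with proj₁ T ⊆? segment σ j
  ... | yes T⊆ = χ-∈ (T⊆ (last∈ σ T))
  ... | no  T⊈ = χ-∉ λ last∈B → T⊈ λ {i} i∈T → subst (_∈ segment σ j) (inverseʳ σ)
    (∈-initialSegment⁺ σ (ℕ.≤-<-trans (last-max σ T i∈T)
      (∈-initialSegment⁻ σ {a = suc (toℕ j)} (subst (_∈ segment σ j) (sym (inverseʳ σ)) last∈B))))

  denominator-rays : ∀ x → (∑[ T ∈ Ts ] x T) ≡ 0# → ∀ σ j →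
                     denominator Ts Δ x 𝟎 (rays σ j) ≡ - ∑⊆ (segment σ j) x
  denominator-rays x ∑x≡0 σ j = trans
    (cong₂ _+_ (∑ₗ-cong Ts term) (sum-zero λ k → zeroʳ (rays σ j k)))
    (trans (+-identityʳ _) (trans
      (trans (∑ₗ-+ Ts (λ T → - 1# * (x T * inB T)) (λ T → x T * s))
        (cong₂ _+_ (∑ₗ-*ˡ Ts (λ T → x T * inB T) (- 1#))
                   -- The shift of the ray enters as a multiple of the total of x, which is 0.
                   (trans (∑ₗ-*ʳ Ts x s) (trans (cong (_* s) ∑x≡0) (zeroˡ s)))))
      (trans (cong (λ z → - 1# * z + 0#) (sym (∑ₗ-filter (λ T → proj₁ T ⊆? segment σ j) Ts x)))
        (solve 1 (λ y → :- con (+ 1) :* y :+ con (+ 0) := :- y) refl _))))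
    where
    s : Carrier
    s = shift (segment σ j)
    inB : NonemptySubset n → Carrier
    inB T = if does (proj₁ T ⊆? segment σ j) then 1# else 0#
    term : ∀ T → x T * h (Δ T) (rays σ j) ≡ - 1# * (x T * inB T) + x T * s
    term T = trans
      (cong (λ z → x T * - z) (trans (min-inChamber σ (rays σ j) T (rays-inChamber σ j))
                                     (cong (_- s) (χ-last σ j T))))
      (solve 3 (λ x b s → x :* :- (b :- s) := :- con (+ 1) :* (x :* b) :+ x :* s) refl (x T) (inB T) s)

  -- Lets a product be inverted by exhibiting its cofactor; that x is nonzero follows from the
  -- equation itself.
  ⁻¹-unique : ∀ {x y} → x * y ≡ 1# → x ⁻¹ ≡ y
  ⁻¹-unique {x} {y} xy≡1 = trans (sym (*-identityˡ _)) (trans (cong (_* x ⁻¹) (sym xy≡1))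
    (trans (solve 3 (λ x y x⁻¹ → x :* y :* x⁻¹ := y :* (x :* x⁻¹)) refl x y (x ⁻¹))
      (trans (cong (y *_) (*-inverseʳ x x≢0)) (*-identityʳ y))))
    where
    x≢0 : x ≢ 0#
    x≢0 refl = 0≢1 (trans (sym (zeroˡ y)) xy≡1)

  -- Each denominator is a negated subset sum; pulling out the r signs produces the power of -1 in
  -- the final formula.
  ∏-neg-inverse : ∀ {r} (y : Fin r → Carrier) → (∀ j → y j ≢ 0#) →
                  ∏ (λ j → - y j) * ((- 1#) ^ r * ∏ (λ j → y j ⁻¹)) ≡ 1#
  ∏-neg-inverse {zero}  y y≢0 = solve 0 (con (+ 1) :* (con (+ 1) :* con (+ 1)) := con (+ 1)) refl
  ∏-neg-inverse {suc r} y y≢0 = trans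
    (solve 5 (λ y y⁻¹ p s q → :- y :* p :* (:- con (+ 1) :* s :* (y⁻¹ :* q)) :=
                              y :* y⁻¹ :* (p :* (s :* q))) refl
       (y zero) (y zero ⁻¹) (∏ λ j → - y (suc j)) ((- 1#) ^ r) (∏ λ j → y (suc j) ⁻¹))
    (trans (cong₂ _*_ (*-inverseʳ (y zero) (y≢0 zero)) (∏-neg-inverse (y ∘ suc) (y≢0 ∘ suc)))
           (*-identityˡ 1#))

  ∏-cong : ∀ {r} {f g : Fin r → Carrier} → (∀ j → f j ≡ g j) → ∏ f ≡ ∏ g
  ∏-cong {zero}  f≗g = refl
  ∏-cong {suc r} f≗g = cong₂ _*_ (f≗g zero) (∏-cong (f≗g ∘ suc))

  dualVolumeSum-fan : ∀ x → (∑[ T ∈ Ts ] x T) ≡ 0# → (∀ σ j → ∑⊆ (segment σ j) x ≢ 0#) →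
    dualVolumeSum Ts Δ fan x 𝟎 ≡
    (- 1#) ^ m * (∑[ σ ∈ permutations n ] (∏ λ j → (∑⊆ (segment σ j) x) ⁻¹))
  dualVolumeSum-fan x ∑x≡0 x≢0 = trans
    (sum-cong λ a → term (permutation a))
    (trans (∑ₗ-lookup (permutations n) (λ σ → (- 1#) ^ m * (∏ λ j → (∑⊆ (segment σ j) x) ⁻¹)))
      (∑ₗ-*ˡ (permutations n) (λ σ → ∏ λ j → (∑⊆ (segment σ j) x) ⁻¹) ((- 1#) ^ m)))
    where
    term : ∀ σ → ∣ det (VecF.insertAt (rays σ) (fromℕ m) 𝟏) ∣ *
                 (∏ λ j → denominator Ts Δ x 𝟎 (rays σ j)) ⁻¹ ≡
                 (- 1#) ^ m * (∏ λ j → (∑⊆ (segment σ j) x) ⁻¹)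
    term σ = trans
      (cong₂ _*_ (∣det-rays∣ σ) (cong _⁻¹ (∏-cong (denominator-rays x ∑x≡0 σ))))
      (trans (*-identityˡ _) (⁻¹-unique (∏-neg-inverse (λ j → ∑⊆ (segment σ j) x) (x≢0 σ))))

proposition13p2 :
    ∀ {c ℓ} (K : OrderedField c ℓ) (m : ℕ) →
    let open OrderedField K
        open Geometry K
        n = suc m
    in
    ∀ (m̃ : (NonemptySubset n → Carrier) → Point n → Carrier) →
    IsHyperplaneDualMixedVolume (nonemptySubsets n) Δ m̃ →
    ∀ (x : NonemptySubset n → Carrier) →
    (∑[ T ∈ nonemptySubsets n ] x T) ≡ 0# →
    (∀ σ (a : Fin m) → ∑⊆ (initialSegment σ (suc (toℕ a))) x ≢ 0#) →
    m̃ x 𝟎 ≡ (- 1#) ^ m *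
      (∑[ σ ∈ permutations n ] (∏ λ (a : Fin m) → (∑⊆ (initialSegment σ (suc (toℕ a))) x) ⁻¹))
proposition13p2 K m m̃ isDualVolume x ∑x≡0 x≢0 =
  -- The defining property of `m̃` holds for every triangulation, so its instance at the braid fan
  -- already fixes the value.
  trans (isDualVolume fan fan-isTriangulation x 𝟎 denominator≢0) (dualVolumeSum-fan x ∑x≡0 x≢0)
  where
  open OrderedField K
  open Geometry K
  open OrderedFieldProperties K
  open MinimumSum K m
  open Chambers K m
  open Evaluation K m
  open IntegerRingSolver K
  denominator≢0 : ∀ a j → denominator Ts Δ x 𝟎 (fan a j) ≢ 0#
  denominator≢0 a j eq = x≢0 (permutation a) j
    (trans (solve 1 (λ y → y := :- :- y) refl _)
      (trans (cong -_ (trans (sym (denominator-rays x ∑x≡0 (permutation a) j)) eq))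
        (solve 0 (:- con (+ 0) := con (+ 0)) refl)))
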